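{- For every integer $m\ge 1$ and every integer $c\ge 1$ there exists $s_0$ such that for all integers $s\ge s_0$, with $n=ms+c$ and $\ell=s-c$, \[ e(n,s)=|\mathcal Q(m,s,\ell)|. \] Moreover: \begin{itemize} \item if $c\ge 2$, then $\mathcal Q(m,s,\ell)$ is the unique shifted family $\mathcal F\subset 2^{[n]}$ with $\nu(\mathcal F)<s$ and $|\mathcal F|=e(n,s)$; \item if $c=1$, then $\mathcal Q(m,s,\ell)$ and $\mathcal W(m,s,\ell)$ are the only shifted families $\mathcal F\subset 2^{[n]}$ with $\nu(\mathcal F)<s$ and $|\mathcal F|=e(n,s)$. \end{itemize}
   Context: For integers $a\le b$, $[a,b]=\{a,\dots,b\}$ and $[b]=[1,b]$. A matching is a collection of pairwise disjoint sets; $\nu(\mathcal F)$ is the maximum size of a matching contained in the family $\mathcal F$. Define \[ e(n,s)=\max\{|\mathcal F|:\mathcal F\subset 2^{[n]},\ \nu(\mathcal F)<s\}. \] For $n=ms+c$ with $1\le c\le s$ and $\ell=s-c$, define \[ \mathcal Q(m,s,\ell)=\{P\subset[n]: |P|+|P\cap[ms-c-1]|\ge 2m\},\qquad \mathcal W(m,s,\ell)=\{P\subset[n]: |P\cap[ms-1]|\ge m\}. \] Writing a set as $(a_1,\dots,a_k)$ with $a_1<\dots<a_k$, a set $(a_1,\dots,a_k)$ can be shifted to $(b_1,\dots,b_k)$ if $a_i\ge b_i$ for all $i\in[k]$. A family $\mathcal F$ is shifted if whenever $A\in\mathcal F$ and $A$ can be shifted to $B$, then $B\in\mathcal F$. 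-}

module Defs where

open import Data.Bool using (Bool; true; false; T)
open import Data.Nat using (ℕ; zero; suc; _+_; _*_; _∸_; _≤_; _≥_; _≤ᵇ_)
open import Data.Nat.Properties using (_≤?_)
open import Data.Fin using (Fin)
open import Data.Fin.Subset using (Subset; _∩_; ⊥)
open import Data.Vec using ([]; _∷_)
open import Data.List using (List; []; _∷_; map; filter; length; _++_)
open import Data.List.Relation.Binary.Pointwise using (Pointwise)
open import Data.Product using (Σ; _×_)
open import Relation.Binary.PropositionalEquality using (_≡_; _≢_)
open import Relation.Nullary using (¬_)

-- Subsets of [n] = {1,…,n}: a Subset n (Vec Bool n); position i (0-based)
-- represents the element i+1.

elemsFrom : ∀ {n} → ℕ → Subset n → List ℕ
elemsFrom k [] = []
elemsFrom k (true ∷ p) = k ∷ elemsFrom (suc k) p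
elemsFrom k (false ∷ p) = elemsFrom (suc k) p

elems : ∀ {n} → Subset n → List ℕ
elems = elemsFrom 1

size : ∀ {n} → Subset n → ℕ
size P = length (elems P)

sizeBelow : ∀ {n} → ℕ → Subset n → ℕ
sizeBelow a P = length (filter (_≤? a) (elems P))

allSubsets : ∀ n → List (Subset n)
allSubsets zero = [] ∷ []
allSubsets (suc n) = map (false ∷_) (allSubsets n) ++ map (true ∷_) (allSubsets n)

Family : ℕ → Set
Family n = Subset n → Bool

card : ∀ {n} → Family n → ℕ
card {n} F = length (filter (λ P → T? (F P)) (allSubsets n))
  where
  open import Relation.Nullary.Decidable using (Dec)
  open import Data.Bool.Properties using (T?)

HasMatching : ∀ {n} → Family n → ℕ → Set
HasMatching {n} F s =
  Σ (Fin s → Subset n) λ f →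
    (∀ i → T (F (f i))) ×
    (∀ i j → i ≢ j → (f i ≢ f j) × (f i ∩ f j ≡ ⊥))

νLt : ∀ {n} → Family n → ℕ → Set
νLt F s = ¬ HasMatching F s

IsE : ℕ → ℕ → ℕ → Set
IsE n s k =
  (Σ (Family n) λ F → νLt F s × card F ≡ k) ×
  (∀ (F : Family n) → νLt F s → card F ≤ k)

CanShift : ∀ {n} → Subset n → Subset n → Set
CanShift A B = Pointwise _≥_ (elems A) (elems B)

Shifted : ∀ {n} → Family n → Set
Shifted F = ∀ A B → T (F A) → CanShift A B → T (F B)

_≐_ : ∀ {n} → Family n → Family n → Set
F ≐ G = ∀ P → F P ≡ G P

Q : (m s c : ℕ) → Family (m * s + c)
Q m s c P = (2 * m) ≤ᵇ (size P + sizeBelow (m * s ∸ c ∸ 1) P)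

W : (m s c : ℕ) → Family (m * s + c)
W m s c P = m ≤ᵇ sizeBelow (m * s ∸ 1) P

{-# OPTIONS --safe #-}
module Submission where

-- Compressions reduce the problem to shifted families F.  Put w = m − 1, let L be the last K points, where
-- K depends on m and c only, and call S ⊆ L present if A ∪ S ∈ F for the set A of w consecutive points
-- following the first X = (K + 1) w ones.  By shiftedness A may be replaced by any w of the first X points,
-- while an absent S costs F about C(n, w) sets.  As Q misses about (2c + 2) C(n, w) sets, a family of size at
-- least |Q| has at most 2c + 2 absent S.  Similarly, since K is large, F contains a set A′ ∪ {min L} with
-- A′ the w points that follow the first D = w s ones; so F contains all m-sets outside L with at most one
-- point beyond D.  With these, any P ∈ F and any disjoint present sets can be completed greedily to a matching
-- whose size is limited only by the number of points.  Hence there are no K − c disjoint present sets, and a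
-- shifted family on K points with this property and at most 2c + 2 absent sets contains either all
-- pairs and all singletons but the last 2c + 1, or, if c = 1, all singletons but the last two.  In the first
-- case a member of F outside Q would complete to a matching of size s, so F ⊆ Q; in the second one
-- F ⊆ W for the same reason.

open import Defs
open import Data.Bool using (Bool; true; false; T; not; _∧_; _∨_)
open import Data.Bool.Properties using (T?; T-≡)
open import Data.Empty using (⊥-elim) renaming (⊥ to ⊥₀)
open import Data.Fin using (Fin; zero; suc)
open import Data.Fin.Properties as Fin using (any?)
open import Data.Fin.Subset using (Subset; _∩_; ⊥) renaming (⊤ to full)
open import Data.Fin.Subset.Properties using (anySubset?; ∩-idem; ∩-comm)
open import Data.List as List using (List; []; _∷_; length; filter)
open import Data.List using () renaming ([] to ε; _∷_ to infixr 5 _∙_)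
open import Data.List.Properties using (length-++; filter-++; filter-accept; filter-reject)
open import Data.List.Relation.Binary.Pointwise as Pw using (Pointwise; []; _∷_)
open import Data.Nat
open import Data.Nat.Induction using (<-wellFounded)
open import Data.Nat.Properties
open import Data.Nat.Tactic.RingSolver using (solve)
open import Data.Product using (Σ; ∃; _×_; _,_; proj₁; proj₂)
open import Data.Sum using (_⊎_; inj₁; inj₂; fromInj₁; map₂)
open import Data.Unit using (⊤; tt)
open import Data.List.Relation.Unary.All as All using (All; []; _∷_)
import Data.List.Relation.Unary.All.Properties as AllP
open import Data.List.Relation.Unary.AllPairs using ([]; _∷_)
open import Data.List.Relation.Unary.Unique.Propositional using (Unique)
import Data.List.Relation.Unary.Unique.Propositional.Properties as Unique
open import Data.Vec using ([]; _∷_; _++_; head; tail; splitAt)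
open import Function using (_∘_; Equivalence)
open import Relation.Binary.Definitions using (tri<; tri≈; tri>)
open import Induction.WellFounded using (Acc; acc)
open import Relation.Binary.PropositionalEquality
open import Relation.Nullary using (¬_; Dec; yes; no)
open import Relation.Nullary.Decidable using (¬?; _×-dec_; decidable-stable)

-- Adding the hypothesis l ≤ r to the goal turns a linear inequality into an identity with slack k.
≤-by : ∀ {l r a b} k → l ≤ r → a + r + k ≡ b + l → a ≤ b
≤-by {l} {r} {a} {b} k h e =
  +-cancelʳ-≤ r a b (≤-trans (m≤m+n (a + r) k) (≤-trans (≤-reflexive e) (+-monoʳ-≤ b h)))

-- The type of *-monoʳ-≤ does not reduce to a shape that the solver can read.
scale : ∀ k {a b} → a ≤ b → k * a ≤ k * b
scale k h = *-monoʳ-≤ k h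

interchange : ∀ a b c d → (a + b) + (c + d) ≡ (a + c) + (b + d)
interchange a b c d = solve (a ∙ b ∙ c ∙ d ∙ ε)

bit : Bool → ℕ
bit true = 1
bit false = 0

bit-mono : ∀ x y → (T x → T y) → bit x ≤ bit y
bit-mono true true _ = ≤-refl
bit-mono true false h = ⊥-elim (h tt)
bit-mono false _ _ = z≤n

-- Sums over all subsets

sumOver : ∀ {n} → (Subset n → ℕ) → ℕ
sumOver {zero} h = h []
sumOver {suc n} h = sumOver (λ P → h (false ∷ P)) + sumOver (λ P → h (true ∷ P))

sumOver-cong : ∀ {n} {g h : Subset n → ℕ} → (∀ P → g P ≡ h P) → sumOver g ≡ sumOver h
sumOver-cong {zero} e = e []
sumOver-cong {suc n} e = cong₂ _+_ (sumOver-cong (e ∘ (false ∷_))) (sumOver-cong (e ∘ (true ∷_)))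

sumOver-mono : ∀ {n} {g h : Subset n → ℕ} → (∀ P → g P ≤ h P) → sumOver g ≤ sumOver h
sumOver-mono {zero} e = e []
sumOver-mono {suc n} e = +-mono-≤ (sumOver-mono (e ∘ (false ∷_))) (sumOver-mono (e ∘ (true ∷_)))

sumOver-mono-< : ∀ {n} {g h : Subset n → ℕ} → (∀ P → g P ≤ h P) → ∀ P → g P < h P → sumOver g < sumOver h
sumOver-mono-< e [] lt = lt
sumOver-mono-< e (false ∷ P) lt = +-mono-<-≤ (sumOver-mono-< (e ∘ (false ∷_)) P lt) (sumOver-mono (e ∘ (true ∷_)))
sumOver-mono-< e (true ∷ P) lt = +-mono-≤-< (sumOver-mono (e ∘ (false ∷_))) (sumOver-mono-< (e ∘ (true ∷_)) P lt)

sumOver-+ : ∀ {n} (g h : Subset n → ℕ) → sumOver (λ P → g P + h P) ≡ sumOver g + sumOver h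
sumOver-+ {zero} g h = refl
sumOver-+ {suc n} g h =
  trans (cong₂ _+_ (sumOver-+ (g ∘ (false ∷_)) (h ∘ (false ∷_))) (sumOver-+ (g ∘ (true ∷_)) (h ∘ (true ∷_))))
        (interchange (sumOver (g ∘ (false ∷_))) (sumOver (h ∘ (false ∷_))) (sumOver (g ∘ (true ∷_))) _)

sumOver-* : ∀ {n} (g : Subset n → ℕ) c → sumOver (λ P → g P * c) ≡ sumOver g * c
sumOver-* {zero} g c = refl
sumOver-* {suc n} g c =
  trans (cong₂ _+_ (sumOver-* (g ∘ (false ∷_)) c) (sumOver-* (g ∘ (true ∷_)) c))
        (sym (*-distribʳ-+ c (sumOver (g ∘ (false ∷_))) _))

sumOver-++ : ∀ a {b} (h : Subset (a + b) → ℕ) → sumOver h ≡ sumOver (λ (A : Subset a) → sumOver (λ B → h (A ++ B)))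
sumOver-++ zero h = refl
sumOver-++ (suc a) h = cong₂ _+_ (sumOver-++ a (h ∘ (false ∷_))) (sumOver-++ a (h ∘ (true ∷_)))

count : ∀ {n} → Family n → ℕ
count F = sumOver (bit ∘ F)

countIn : ∀ {A : Set} → (A → Bool) → List A → ℕ
countIn F xs = length (filter (λ x → T? (F x)) xs)

countIn-map : ∀ {A B : Set} (F : B → Bool) (f : A → B) xs → countIn F (List.map f xs) ≡ countIn (F ∘ f) xs
countIn-map F f [] = refl
countIn-map F f (x ∷ xs) with F (f x)
... | true = cong suc (countIn-map F f xs)
... | false = countIn-map F f xs

card≡count : ∀ {n} (F : Family n) → card F ≡ count F
card≡count {zero} F with F []
... | true = refl
... | false = refl
card≡count {suc n} F = begin
  length (filter T?F (xs List.++ ys))                ≡⟨ cong length (filter-++ T?F xs ys) ⟩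
  length (filter T?F xs List.++ filter T?F ys)       ≡⟨ length-++ (filter T?F xs) ⟩
  countIn F xs + countIn F ys                        ≡⟨ cong₂ _+_ (countIn-map F _ (allSubsets n)) (countIn-map F _ (allSubsets n)) ⟩
  card (F ∘ (false ∷_)) + card (F ∘ (true ∷_))       ≡⟨ cong₂ _+_ (card≡count (F ∘ (false ∷_))) (card≡count (F ∘ (true ∷_))) ⟩
  count F ∎
  where
  open ≡-Reasoning
  T?F = λ P → T? (F P)
  xs = List.map (false ∷_) (allSubsets n)
  ys = List.map (true ∷_) (allSubsets n)

count-complement : ∀ {n} (F : Family n) → count F + count (not ∘ F) ≡ sumOver {n} (λ _ → 1)
count-complement F = trans (sym (sumOver-+ (bit ∘ F) (bit ∘ not ∘ F))) (sumOver-cong λ P → one (F P))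
  where
  one : ∀ x → bit x + bit (not x) ≡ 1
  one true = refl
  one false = refl

count-mono : ∀ {n} (F G : Family n) → (∀ P → T (F P) → T (G P)) → count F ≤ count G
count-mono F G F⊆G = sumOver-mono λ P → bit-mono (F P) (G P) (F⊆G P)

⊆∧count≡⇒≐ : ∀ {n} (F G : Family n) → (∀ P → T (F P) → T (G P)) → count F ≡ count G → F ≐ G
⊆∧count≡⇒≐ F G F⊆G e P with F P in eF | G P in eG
... | true | true = refl
... | false | false = refl
... | true | false = ⊥-elim (subst T eG (F⊆G P (subst T (sym eF) tt)))
... | false | true = ⊥-elim (<-irrefl e (sumOver-mono-< (λ R → bit-mono (F R) (G R) (F⊆G R)) P (subst₂ (λ x y → bit x < bit y) (sym eF) (sym eG) (s≤s z≤n))))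

-- Cardinalities and initial segments

# : ∀ {n} → Subset n → ℕ
# [] = 0
# (b ∷ P) = bit b + # P

-- Positions are 0-based, so lo k P is |P ∩ [k]|; hi k P counts the other elements.
lo : ∀ {n} → ℕ → Subset n → ℕ
lo zero _ = 0
lo (suc k) [] = 0
lo (suc k) (b ∷ P) = bit b + lo k P

hi : ∀ {n} → ℕ → Subset n → ℕ
hi zero P = # P
hi (suc k) [] = 0
hi (suc k) (b ∷ P) = hi k P

lo+hi : ∀ {n} k (P : Subset n) → lo k P + hi k P ≡ # P
lo+hi zero P = refl
lo+hi (suc k) [] = refl
lo+hi (suc k) (b ∷ P) = trans (+-assoc (bit b) _ _) (cong (bit b +_) (lo+hi k P))

lo≤# : ∀ {n} k (P : Subset n) → lo k P ≤ # P
lo≤# k P = subst (lo k P ≤_) (lo+hi k P) (m≤m+n (lo k P) (hi k P))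

bit≤1 : ∀ b → bit b ≤ 1
bit≤1 true = ≤-refl
bit≤1 false = z≤n

lo≤ : ∀ {n} k (P : Subset n) → lo k P ≤ k
lo≤ zero P = z≤n
lo≤ (suc k) [] = z≤n
lo≤ (suc k) (b ∷ P) = +-mono-≤ (bit≤1 b) (lo≤ k P)

#≡lo : ∀ {n} (P : Subset n) → lo n P ≡ # P
#≡lo [] = refl
#≡lo (b ∷ P) = cong (bit b +_) (#≡lo P)

#-++ : ∀ {a b} (A : Subset a) (B : Subset b) → # (A ++ B) ≡ # A + # B
#-++ [] B = refl
#-++ (x ∷ A) B = trans (cong (bit x +_) (#-++ A B)) (sym (+-assoc (bit x) _ _))

lo-++ : ∀ {a b} (A : Subset a) (B : Subset b) k → lo (a + k) (A ++ B) ≡ # A + lo k B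
lo-++ [] B k = refl
lo-++ (x ∷ A) B k = trans (cong (bit x +_) (lo-++ A B k)) (sym (+-assoc (bit x) _ _))

size-from : ∀ {n} k (P : Subset n) → length (elemsFrom k P) ≡ # P
size-from k [] = refl
size-from k (true ∷ P) = cong suc (size-from (suc k) P)
size-from k (false ∷ P) = size-from (suc k) P

size≡# : ∀ {n} (P : Subset n) → size P ≡ # P
size≡# = size-from 1

filter-above : ∀ {n} j k a (P : Subset n) → a < k → length (filter (_≤? a) (elemsFrom (k + j) P)) ≡ 0
filter-above j k a [] lt = refl
filter-above j k a (false ∷ P) lt = subst (λ z → length (filter (_≤? a) (elemsFrom z P)) ≡ 0) (+-suc k j) (filter-above (suc j) k a P lt)
filter-above j k a (true ∷ P) lt with k + j ≤ᵇ a in eq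
... | false = subst (λ z → length (filter (_≤? a) (elemsFrom z P)) ≡ 0) (+-suc k j) (filter-above (suc j) k a P lt)
... | true = ⊥-elim (<⇒≱ lt (≤-trans (m≤m+n k j) (≤ᵇ⇒≤ (k + j) a (subst T (sym eq) tt))))

-- The offset `k` counts the positions already read. The numeric cutoff `a + k` is constant along
-- the induction, as units pass from `a` to `k`.
sizeBelow-from : ∀ {n} k a (P : Subset n) → length (filter (_≤? (a + k)) (elemsFrom (suc k) P)) ≡ lo a P
sizeBelow-from k zero P = trans (cong (λ z → length (filter (_≤? k) (elemsFrom z P))) (sym (+-identityʳ (suc k)))) (filter-above 0 (suc k) k P ≤-refl)
sizeBelow-from k (suc a) [] = refl
sizeBelow-from k (suc a) (false ∷ P) = trans (cong (λ z → length (filter (_≤? z) (elemsFrom (suc (suc k)) P))) (sym (+-suc a k))) (sizeBelow-from (suc k) a P)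
sizeBelow-from k (suc a) (true ∷ P) with k <ᵇ suc (a + k) in eq
... | true = cong suc (trans (cong (λ z → length (filter (_≤? z) (elemsFrom (suc (suc k)) P))) (sym (+-suc a k))) (sizeBelow-from (suc k) a P))
... | false = ⊥-elim (subst T eq (<⇒<ᵇ (s≤s (m≤n+m k a))))

sizeBelow≡lo : ∀ {n} a (P : Subset n) → sizeBelow a P ≡ lo a P
sizeBelow≡lo a P = trans (cong (λ z → length (filter (_≤? z) (elems P))) (sym (+-identityʳ a))) (sizeBelow-from 0 a P)

-- The shifting order

-- Ballot paths: reading A and B from the left, B is ahead of A by d trues before and by e trues after,
-- and never falls behind.  For d = e = 0 this says that A can be shifted to B.
data Dom : ∀ {n} → ℕ → Subset n → Subset n → ℕ → Set where
  []   : ∀ {d} → Dom d [] [] d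
  same : ∀ {n d e} b {A B : Subset n} → Dom d A B e → Dom d (b ∷ A) (b ∷ B) e
  gain : ∀ {n d e} {A B : Subset n} → Dom (suc d) A B e → Dom d (false ∷ A) (true ∷ B) e
  lose : ∀ {n d e} {A B : Subset n} → Dom d A B e → Dom (suc d) (true ∷ A) (false ∷ B) e

Dom-refl : ∀ {n d} (A : Subset n) → Dom d A A d
Dom-refl [] = []
Dom-refl (b ∷ A) = same b (Dom-refl A)

Dom-++ : ∀ {a b d e f} {A B : Subset a} {C D : Subset b} → Dom d A B e → Dom e C D f → Dom d (A ++ C) (B ++ D) f
Dom-++ [] q = q
Dom-++ (same b p) q = same b (Dom-++ p q)
Dom-++ (gain p) q = gain (Dom-++ p q)
Dom-++ (lose p) q = lose (Dom-++ p q)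

DomClosed : ∀ {n} → Family n → Set
DomClosed F = ∀ {A B} → Dom 0 A B 0 → T (F A) → T (F B)

data Step : ∀ {n} → Subset n → Subset n → Set where
  here  : ∀ {n} {P : Subset n} → Step (false ∷ true ∷ P) (true ∷ false ∷ P)
  there : ∀ {n b} {P R : Subset n} → Step P R → Step (b ∷ P) (b ∷ R)

Stable : ∀ {n} → Family n → Set
Stable F = ∀ {A B} → Step A B → T (F A) → T (F B)

elems-refl : ∀ (xs : List ℕ) → Pointwise _≥_ xs xs
elems-refl xs = Pw.refl ≤-refl

Step⇒≥ : ∀ {n} k {A B : Subset n} → Step A B → Pointwise _≥_ (elemsFrom k A) (elemsFrom k B)
Step⇒≥ k here = n≤1+n k ∷ elems-refl _
Step⇒≥ k (there {b = true} s) = ≤-refl ∷ Step⇒≥ (suc k) s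
Step⇒≥ k (there {b = false} s) = Step⇒≥ (suc k) s

Shifted⇒Stable : ∀ {n} {F : Family n} → Shifted F → Stable F
Shifted⇒Stable sh {A} {B} s FA = sh A B FA (Step⇒≥ 1 s)

data Drop : ∀ {n} → Subset n → Subset n → Set where
  here  : ∀ {n} {P : Subset n} → Drop (true ∷ P) (false ∷ P)
  there : ∀ {n} {P R : Subset n} → Drop P R → Drop (false ∷ P) (false ∷ R)

-- Once the first element of `A` is removed, an initial lead smaller by one suffices. This element
-- exists since the lead has to come down to 0.
Dom-drop : ∀ {n d} {A B : Subset n} → Dom (suc d) A B 0 → ∃ λ A′ → Drop A A′ × Dom d A′ B 0
Dom-drop (same true p) = _ , here , gain p
Dom-drop (same false p) with Dom-drop p
... | A′ , r , q = _ , there r , same false q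
Dom-drop (gain p) with Dom-drop p
... | A′ , r , q = _ , there r , gain q
Dom-drop (lose p) = _ , here , same false p

Stable-drop : ∀ {n} {F : Family (suc n)} {A A′ : Subset n} → Stable F → Drop A A′ → T (F (false ∷ A)) → T (F (true ∷ A′))
Stable-drop st here FA = st here FA
Stable-drop {F = F} st (there r) FA = st here (Stable-drop {F = F ∘ (false ∷_)} (st ∘ there) r FA)

-- The path is followed from the left. Where `B` gains a point, the next element of `A` is moved
-- down to it by adjacent steps; the two sets then agree there and the rest is still a valid path.
Stable⇒DomClosed : ∀ {n} {F : Family n} → Stable F → DomClosed F
Stable⇒DomClosed st [] FA = FA
Stable⇒DomClosed {F = F} st (same b p) FA = Stable⇒DomClosed {F = F ∘ (b ∷_)} (st ∘ there) p FA
Stable⇒DomClosed {F = F} st (gain p) FA with Dom-drop p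
... | A′ , r , q = Stable⇒DomClosed {F = F ∘ (true ∷_)} (st ∘ there) q (Stable-drop {F = F} st r FA)

DomClosed-++ : ∀ {a b} {F : Family (a + b)} (A : Subset a) → DomClosed F → DomClosed (λ B → F (A ++ B))
DomClosed-++ A cl p = cl (Dom-++ (Dom-refl A) p)

-- Compressions

-- The compression between the first two points: of two sets that differ only in which of these they
-- contain, the one with the earlier point is preferred.
squash : ∀ {n} → Family (2 + n) → Family (2 + n)
squash F (true ∷ false ∷ P) = F (true ∷ false ∷ P) ∨ F (false ∷ true ∷ P)
squash F (false ∷ true ∷ P) = F (true ∷ false ∷ P) ∧ F (false ∷ true ∷ P)
squash F (true ∷ true ∷ P) = F (true ∷ true ∷ P)
squash F (false ∷ false ∷ P) = F (false ∷ false ∷ P)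

compress : ℕ → ∀ {n} → Family n → Family n
compress zero {suc (suc n)} F = squash F
compress (suc i) {suc n} F (b ∷ P) = compress i (F ∘ (b ∷_)) P
compress zero {zero} F = F
compress zero {suc zero} F = F
compress (suc i) {zero} F = F

swap : ∀ {n} → ℕ → Subset n → Subset n
swap zero (x ∷ y ∷ P) = y ∷ x ∷ P
swap (suc i) (x ∷ P) = x ∷ swap i P
swap i P = P

member : ∀ {n} → ℕ → Subset n → Bool
member i [] = false
member zero (x ∷ P) = x
member (suc i) (x ∷ P) = member i P

compress-top : ∀ {n} i (F : Family n) A → T (compress i F A) → T (F A) ⊎ (T (F (swap i A)) × member i A ≡ true)
compress-top {zero} zero F A h = inj₁ h
compress-top {zero} (suc i) F A h = inj₁ h
compress-top {suc zero} zero F A h = inj₁ h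
compress-top {suc (suc n)} zero F (true ∷ true ∷ P) h = inj₁ h
compress-top {suc (suc n)} zero F (false ∷ false ∷ P) h = inj₁ h
compress-top {suc (suc n)} zero F (true ∷ false ∷ P) h with F (true ∷ false ∷ P)
... | true = inj₁ tt
... | false = inj₂ (h , refl)
compress-top {suc (suc n)} zero F (false ∷ true ∷ P) h with F (true ∷ false ∷ P) | F (false ∷ true ∷ P)
... | true | true = inj₁ tt
compress-top {suc n} (suc i) F (b ∷ P) h = compress-top i (F ∘ (b ∷_)) P h

-- A set with only the later point survives the compression only if both versions lie in `F`; a set
-- with neither point is fixed by the swap.
compress-free : ∀ {n} i (F : Family n) A → member i A ≡ false → T (compress i F A) → T (F (swap i A))
compress-free {zero} zero F [] e h = h
compress-free {zero} (suc i) F [] e h = h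
compress-free {suc zero} zero F (x ∷ []) e h = h
compress-free {suc (suc n)} zero F (false ∷ false ∷ P) e h = h
compress-free {suc (suc n)} zero F (false ∷ true ∷ P) e h with F (true ∷ false ∷ P) | F (false ∷ true ∷ P)
... | true | true = tt
compress-free {suc n} (suc i) F (b ∷ P) e h = compress-free i (F ∘ (b ∷_)) P e h

swap-involutive : ∀ {n} i (A : Subset n) → swap i (swap i A) ≡ A
swap-involutive zero [] = refl
swap-involutive zero (x ∷ []) = refl
swap-involutive zero (x ∷ y ∷ P) = refl
swap-involutive (suc i) [] = refl
swap-involutive (suc i) (x ∷ P) = cong (x ∷_) (swap-involutive i P)

swap-∩ : ∀ {n} i (A B : Subset n) → swap i A ∩ swap i B ≡ swap i (A ∩ B)
swap-∩ zero [] [] = refl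
swap-∩ zero (x ∷ []) (y ∷ []) = refl
swap-∩ zero (_ ∷ _ ∷ _) (_ ∷ _ ∷ _) = refl
swap-∩ (suc i) [] [] = refl
swap-∩ (suc i) (x ∷ A) (y ∷ B) = cong ((x ∧ y) ∷_) (swap-∩ i A B)

swap-⊥ : ∀ {n} i → swap {n} i ⊥ ≡ ⊥
swap-⊥ {zero} zero = refl
swap-⊥ {suc zero} zero = refl
swap-⊥ {suc (suc n)} zero = refl
swap-⊥ {zero} (suc i) = refl
swap-⊥ {suc n} (suc i) = cong (false ∷_) (swap-⊥ i)

disjoint-member : ∀ {n} i (A B : Subset n) → A ∩ B ≡ ⊥ → member i A ≡ true → member i B ≡ false
disjoint-member zero (true ∷ A) (false ∷ B) e refl = refl
disjoint-member (suc i) (x ∷ A) (y ∷ B) e h = disjoint-member i A B (cong tail e) h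

-- If some member of the matching was created by the compression, then swapping every set gives a matching in F.
compress-matching : ∀ {n s} i (F : Family n) → HasMatching (compress i F) s → HasMatching F s
compress-matching i F (f , f∈ , dis) with any? (λ j → ¬? (T? (F (f j))))
... | no all = f , (λ j → decidable-stable (T? (F (f j))) (λ h → all (j , h))) , dis
... | yes (j , j∉) with compress-top i F (f j) (f∈ j)
... | inj₁ h = ⊥-elim (j∉ h)
... | inj₂ (sw , top) = (swap i ∘ f) , mem , λ a b a≢b →
      (λ e → proj₁ (dis a b a≢b) (trans (sym (swap-involutive i (f a))) (trans (cong (swap i) e) (swap-involutive i (f b)))))
    , trans (swap-∩ i (f a) (f b)) (trans (cong (swap i) (proj₂ (dis a b a≢b))) (swap-⊥ i))
  where
  mem : ∀ k → T (F (swap i (f k)))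
  mem k with j Fin.≟ k
  ... | yes refl = sw
  ... | no j≢k = compress-free i F (f k) (disjoint-member i (f j) (f k) (proj₂ (dis j k j≢k)) top) (f∈ k)

Unstable : ℕ → ∀ {n} → Family n → Set
Unstable zero {suc (suc n)} F = ∃ λ P → T (F (false ∷ true ∷ P)) × ¬ T (F (true ∷ false ∷ P))
Unstable (suc i) {suc n} F = ∃ λ b → Unstable i (F ∘ (b ∷_))
Unstable zero {zero} F = ⊥₀
Unstable zero {suc zero} F = ⊥₀
Unstable (suc i) {zero} F = ⊥₀

stable-∷ : ∀ {n} (F : Family (2 + n)) → (∀ b → Stable (F ∘ (b ∷_)) ⊎ ∃ λ i → Unstable i (F ∘ (b ∷_))) → Stable F ⊎ ∃ λ i → Unstable i F
stable-∷ F rec with anySubset? (λ P → T? (F (false ∷ true ∷ P)) ×-dec ¬? (T? (F (true ∷ false ∷ P))))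
... | yes u = inj₂ (zero , u)
... | no ¬u with rec false | rec true
... | inj₂ (i , u) | _ = inj₂ (suc i , false , u)
... | inj₁ _ | inj₂ (i , u) = inj₂ (suc i , true , u)
... | inj₁ s₀ | inj₁ s₁ = inj₁ λ
      { (here {P = P}) h → decidable-stable (T? _) (λ h′ → ¬u (P , h , h′))
      ; (there {b = false} s) → s₀ s
      ; (there {b = true} s) → s₁ s }

stable? : ∀ {n} (F : Family n) → Stable F ⊎ ∃ λ i → Unstable i F
stable? {zero} F = inj₁ λ ()
stable? {suc zero} F = inj₁ λ { (there ()) }
stable? {suc (suc n)} F = stable-∷ F λ b → stable? (F ∘ (b ∷_))

-- g P should be thought of as a constant plus the sum of the elements of P; it is abstract so that
-- the induction on the prefix goes through.
Graded : ℕ → ∀ {n} → (Subset n → ℕ) → Set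
Graded zero {suc (suc n)} g = ∀ P → g (false ∷ true ∷ P) ≡ suc (g (true ∷ false ∷ P))
Graded (suc i) {suc n} g = ∀ b → Graded i (g ∘ (b ∷_))
Graded zero {zero} g = ⊤
Graded zero {suc zero} g = ⊤
Graded (suc i) {zero} g = ⊤

potential : ∀ {n} → (Subset n → ℕ) → Family n → ℕ
potential g F = sumOver (λ P → bit (F P) * g P)

sum-pair-≡ : ∀ n {a b a′ b′ : Subset n → ℕ} → (∀ P → a P + b P ≡ a′ P + b′ P) → sumOver a + sumOver b ≡ sumOver a′ + sumOver b′
sum-pair-≡ n {a} {b} {a′} {b′} e = trans (sym (sumOver-+ a b)) (trans (sumOver-cong e) (sumOver-+ a′ b′))

sum-pair-≤ : ∀ n {a b a′ b′ : Subset n → ℕ} → (∀ P → a P + b P ≤ a′ P + b′ P) → sumOver a + sumOver b ≤ sumOver a′ + sumOver b′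
sum-pair-≤ n {a} {b} {a′} {b′} e = subst₂ _≤_ (sumOver-+ a b) (sumOver-+ a′ b′) (sumOver-mono e)

sum-pair-< : ∀ n {a b a′ b′ : Subset n → ℕ} → (∀ P → a P + b P ≤ a′ P + b′ P) → ∀ P → a P + b P < a′ P + b′ P →
             sumOver a + sumOver b < sumOver a′ + sumOver b′
sum-pair-< n {a} {b} {a′} {b′} e P lt = subst₂ _<_ (sumOver-+ a b) (sumOver-+ a′ b′) (sumOver-mono-< e P lt)

-- The four summands belong to the four choices of the first two bits. A compression there affects
-- only the two middle ones.
four : ∀ a b c d {b′ c′} → b + c ≡ b′ + c′ → (a + b) + (c + d) ≡ (a + b′) + (c′ + d)
four a b c d {b′} {c′} e = begin
  (a + b) + (c + d)   ≡⟨ solve (a ∙ b ∙ c ∙ d ∙ ε) ⟩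
  a + (b + c) + d     ≡⟨ cong (λ z → a + z + d) e ⟩
  a + (b′ + c′) + d   ≡⟨ solve (a ∙ b′ ∙ c′ ∙ d ∙ ε) ⟩
  (a + b′) + (c′ + d) ∎
  where open ≡-Reasoning

four-≤ : ∀ a b c d {b′ c′} → b + c ≤ b′ + c′ → (a + b) + (c + d) ≤ (a + b′) + (c′ + d)
four-≤ a b c d {b′} {c′} e = ≤-by 0 e (solve (a ∙ b ∙ c ∙ d ∙ b′ ∙ c′ ∙ ε))

four-< : ∀ a b c d {b′ c′} → b + c < b′ + c′ → (a + b) + (c + d) < (a + b′) + (c′ + d)
four-< a b c d {b′} {c′} e = ≤-by 0 e (solve (a ∙ b ∙ c ∙ d ∙ b′ ∙ c′ ∙ ε))

count-compress : ∀ {n} i (F : Family n) → count (compress i F) ≡ count F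
count-compress {zero} zero F = refl
count-compress {zero} (suc i) F = refl
count-compress {suc zero} zero F = refl
count-compress {suc (suc n)} zero F =
  four (sumOver λ P → bit (F (false ∷ false ∷ P))) _ _ (sumOver λ P → bit (F (true ∷ true ∷ P)))
    (sum-pair-≡ n λ P → pw (F (true ∷ false ∷ P)) (F (false ∷ true ∷ P)))
  where
  pw : ∀ x y → bit (x ∧ y) + bit (x ∨ y) ≡ bit y + bit x
  pw true true = refl
  pw true false = refl
  pw false true = refl
  pw false false = refl
count-compress {suc n} (suc i) F = cong₂ _+_ (count-compress i (F ∘ (false ∷_))) (count-compress i (F ∘ (true ∷_)))

squash-bit : ∀ x y {a b} → a ≡ suc b → bit (x ∧ y) * a + bit (x ∨ y) * b ≤ bit y * a + bit x * b
squash-bit true true refl = ≤-refl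
squash-bit true false refl = ≤-refl
squash-bit false true {b = b} refl = ≤-trans (n≤1+n _) (≤-reflexive (sym (+-identityʳ (suc (b + 0)))))
squash-bit false false refl = ≤-refl

squash-bit-< : ∀ x y {a b} → a ≡ suc b → T y → ¬ T x → bit (x ∧ y) * a + bit (x ∨ y) * b < bit y * a + bit x * b
squash-bit-< true y refl ty ¬x = ⊥-elim (¬x tt)
squash-bit-< false true {b = b} refl ty ¬x = ≤-reflexive (sym (+-identityʳ (suc (b + 0))))

potential-compress-≤ : ∀ {n} i (g : Subset n → ℕ) (F : Family n) → Graded i g → potential g (compress i F) ≤ potential g F
potential-compress-≤ {zero} zero g F gr = ≤-refl
potential-compress-≤ {zero} (suc i) g F gr = ≤-refl
potential-compress-≤ {suc zero} zero g F gr = ≤-refl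
potential-compress-≤ {suc (suc n)} zero g F gr =
  four-≤ (sumOver λ P → bit (F (false ∷ false ∷ P)) * g (false ∷ false ∷ P)) _ _ (sumOver λ P → bit (F (true ∷ true ∷ P)) * g (true ∷ true ∷ P))
    (sum-pair-≤ n λ P → squash-bit (F (true ∷ false ∷ P)) (F (false ∷ true ∷ P)) (gr P))
potential-compress-≤ {suc n} (suc i) g F gr =
  +-mono-≤ (potential-compress-≤ i (g ∘ (false ∷_)) (F ∘ (false ∷_)) (gr false)) (potential-compress-≤ i (g ∘ (true ∷_)) (F ∘ (true ∷_)) (gr true))

potential-compress-< : ∀ {n} i (g : Subset n → ℕ) (F : Family n) → Graded i g → Unstable i F → potential g (compress i F) < potential g F
potential-compress-< {suc (suc n)} zero g F gr (P , h , h′) =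
  four-< (sumOver λ P → bit (F (false ∷ false ∷ P)) * g (false ∷ false ∷ P)) _ _ (sumOver λ P → bit (F (true ∷ true ∷ P)) * g (true ∷ true ∷ P))
    (sum-pair-< n (λ P → squash-bit (F (true ∷ false ∷ P)) (F (false ∷ true ∷ P)) (gr P)) P (squash-bit-< (F (true ∷ false ∷ P)) (F (false ∷ true ∷ P)) (gr P) h h′))
potential-compress-< {suc n} (suc i) g F gr (false , u) =
  +-mono-<-≤ (potential-compress-< i (g ∘ (false ∷_)) (F ∘ (false ∷_)) (gr false) u) (potential-compress-≤ i (g ∘ (true ∷_)) (F ∘ (true ∷_)) (gr true))
potential-compress-< {suc n} (suc i) g F gr (true , u) =
  +-mono-≤-< (potential-compress-≤ i (g ∘ (false ∷_)) (F ∘ (false ∷_)) (gr false)) (potential-compress-< i (g ∘ (true ∷_)) (F ∘ (true ∷_)) (gr true) u)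

elementSum : ∀ {n} → ℕ → Subset n → ℕ
elementSum k [] = 0
elementSum k (true ∷ P) = k + elementSum (suc k) P
elementSum k (false ∷ P) = elementSum (suc k) P

elementSum-graded : ∀ {n} i k a {g : Subset n → ℕ} → (∀ P → g P ≡ a + elementSum k P) → Graded i g
elementSum-graded {zero} zero k a e = tt
elementSum-graded {zero} (suc i) k a e = tt
elementSum-graded {suc zero} zero k a e = tt
elementSum-graded {suc (suc n)} zero k a {g} e P =
  trans (e (false ∷ true ∷ P)) (trans (+-suc a _) (cong suc (sym (e (true ∷ false ∷ P)))))
elementSum-graded {suc n} (suc i) k a e true = elementSum-graded i (suc k) (a + k) λ P → trans (e (true ∷ P)) (sym (+-assoc a k _))
elementSum-graded {suc n} (suc i) k a e false = elementSum-graded i (suc k) a λ P → e (false ∷ P)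

-- Compressing an unstable family lowers the sum of all elements of all its members, so the process
-- ends. Each compression keeps the size and creates no matching.
stabilize : ∀ {n s} (F : Family n) → νLt F s → ∃ λ G → Stable G × νLt G s × count G ≡ count F
stabilize {n} {s} F ν = go F (<-wellFounded _) ν
  where
  go : ∀ F → Acc _<_ (potential (elementSum 0) F) → νLt F s → ∃ λ G → Stable G × νLt G s × count G ≡ count F
  go F (acc rec) ν with stable? F
  ... | inj₁ st = F , st , ν , refl
  ... | inj₂ (i , u)
    with go (compress i F) (rec (potential-compress-< i (elementSum 0) F (elementSum-graded i 0 0 λ _ → refl) u)) (ν ∘ compress-matching i F)
  ... | G , st , νG , e = G , st , νG , trans e (count-compress i F)

-- Building matchings

-- `U` is the disjoint union of `A` and `V`; in a matching, `V` holds the points still free.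
data Split : ∀ {n} → Subset n → Subset n → Subset n → Set where
  []    : Split [] [] []
  skip  : ∀ {n} {U A V : Subset n} → Split U A V → Split (false ∷ U) (false ∷ A) (false ∷ V)
  left  : ∀ {n} {U A V : Subset n} → Split U A V → Split (true ∷ U) (true ∷ A) (false ∷ V)
  right : ∀ {n} {U A V : Subset n} → Split U A V → Split (true ∷ U) (false ∷ A) (true ∷ V)

Split-++ : ∀ {a b} {U A V : Subset a} {U′ A′ V′ : Subset b} → Split U A V → Split U′ A′ V′ → Split (U ++ U′) (A ++ A′) (V ++ V′)
Split-++ [] q = q
Split-++ (skip p) q = skip (Split-++ p q)
Split-++ (left p) q = left (Split-++ p q)
Split-++ (right p) q = right (Split-++ p q)

Split-none : ∀ {n} (U : Subset n) → Split U ⊥ U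
Split-none [] = []
Split-none (true ∷ U) = right (Split-none U)
Split-none (false ∷ U) = skip (Split-none U)

Split-trans : ∀ {n} {U A V B W : Subset n} → Split U A V → Split V B W → ∃ λ W′ → Split U B W′
Split-trans [] [] = _ , []
Split-trans (skip p) (skip q) = _ , skip (proj₂ (Split-trans p q))
Split-trans (left p) (skip q) = _ , right (proj₂ (Split-trans p q))
Split-trans (right p) (left q) = _ , left (proj₂ (Split-trans p q))
Split-trans (right p) (right q) = _ , right (proj₂ (Split-trans p q))

Split-disjoint : ∀ {n} {U A V B W : Subset n} → Split U A V → Split V B W → A ∩ B ≡ ⊥
Split-disjoint [] [] = refl
Split-disjoint (skip p) (skip q) = cong (false ∷_) (Split-disjoint p q)
Split-disjoint (left p) (skip q) = cong (false ∷_) (Split-disjoint p q)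
Split-disjoint (right p) (left q) = cong (false ∷_) (Split-disjoint p q)
Split-disjoint (right p) (right q) = cong (false ∷_) (Split-disjoint p q)

lo-Split : ∀ {n} k {U A V : Subset n} → Split U A V → lo k U ≡ lo k A + lo k V
lo-Split zero p = refl
lo-Split (suc k) [] = refl
lo-Split (suc k) (skip p) = lo-Split k p
lo-Split (suc k) (left p) = cong suc (lo-Split k p)
lo-Split (suc k) {A = false ∷ A} (right p) = trans (cong suc (lo-Split k p)) (sym (+-suc (lo k A) _))

#-Split : ∀ {n} {U A V : Subset n} → Split U A V → # U ≡ # A + # V
#-Split {n} {U} {A} {V} p = subst₂ _≡_ (#≡lo U) (cong₂ _+_ (#≡lo A) (#≡lo V)) (lo-Split n p)

complement-Split : ∀ {n} (A : Subset n) → ∃ λ V → Split full A V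
complement-Split [] = _ , []
complement-Split (true ∷ A) = _ , left (proj₂ (complement-Split A))
complement-Split (false ∷ A) = _ , right (proj₂ (complement-Split A))

take : ∀ {n} D a b (U : Subset n) → a ≤ lo D U → b ≤ hi D U → ∃ λ A → ∃ λ V → Split U A V × lo D A ≡ a × hi D A ≡ b
take zero zero zero [] p q = _ , _ , [] , refl , refl
take (suc D) zero zero [] p q = _ , _ , [] , refl , refl
take zero zero b (false ∷ U) p q with take zero zero b U p q
... | A , V , s , e , e′ = _ , _ , skip s , e , e′
take zero zero zero (true ∷ U) p q with take zero zero zero U p z≤n
... | A , V , s , e , e′ = _ , _ , right s , e , e′
take zero zero (suc b) (true ∷ U) p (s≤s q) with take zero zero b U p q
... | A , V , s , e , e′ = _ , _ , left s , e , cong suc e′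
take (suc D) a b (false ∷ U) p q with take D a b U p q
... | A , V , s , e , e′ = _ , _ , skip s , e , e′
take (suc D) zero b (true ∷ U) p q with take D zero b U z≤n q
... | A , V , s , e , e′ = _ , _ , right s , e , e′
take (suc D) (suc a) b (true ∷ U) (s≤s p) q with take D a b U p q
... | A , V , s , e , e′ = _ , _ , left s , cong suc e , e′

-- Members are nonempty, so that disjointness makes them distinct, as `HasMatching` demands.
data Matching {n} (F : Family n) : ℕ → Subset n → Set where
  []  : ∀ {U} → Matching F 0 U
  add : ∀ {s U A V} → Split U A V → 1 ≤ # A → T (F A) → Matching F s V → Matching F (suc s) U

#⊥ : ∀ {n} → # {n} ⊥ ≡ 0
#⊥ {zero} = refl
#⊥ {suc n} = #⊥ {n}

lo-full : ∀ {n} k → k ≤ n → lo {n} k full ≡ k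
lo-full zero p = refl
lo-full (suc k) (s≤s p) = cong suc (lo-full k p)

disjoint⇒≢ : ∀ {n} {A B : Subset n} → A ∩ B ≡ ⊥ → 1 ≤ # A → A ≢ B
disjoint⇒≢ {n} {A = A} e p refl = <-irrefl (sym (trans (cong # (trans (sym (∩-idem A)) e)) (#⊥ {n}))) p

members : ∀ {n s} {F : Family n} {U} → Matching F s U → Fin s → Subset n
members (add {A = A} _ _ _ M) zero = A
members (add _ _ _ M) (suc i) = members M i

members-∈ : ∀ {n s} {F : Family n} {U} (M : Matching F s U) i → T (F (members M i))
members-∈ (add _ _ FA M) zero = FA
members-∈ (add _ _ FA M) (suc i) = members-∈ M i

members-⊆ : ∀ {n s} {F : Family n} {U} (M : Matching F s U) i → ∃ λ W → Split U (members M i) W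
members-⊆ (add p _ _ M) zero = _ , p
members-⊆ (add p _ _ M) (suc i) = Split-trans p (proj₂ (members-⊆ M i))

members-nonempty : ∀ {n s} {F : Family n} {U} (M : Matching F s U) i → 1 ≤ # (members M i)
members-nonempty (add _ p _ M) zero = p
members-nonempty (add _ _ _ M) (suc i) = members-nonempty M i

members-disjoint : ∀ {n s} {F : Family n} {U} (M : Matching F s U) i j → i ≢ j → members M i ∩ members M j ≡ ⊥
members-disjoint M@(add _ _ _ _) zero zero h = ⊥-elim (h refl)
members-disjoint (add p _ _ M) zero (suc j) h = Split-disjoint p (proj₂ (members-⊆ M j))
members-disjoint (add {A = A} p _ _ M) (suc i) zero h = trans (∩-comm _ A) (Split-disjoint p (proj₂ (members-⊆ M i)))
members-disjoint (add _ _ _ M) (suc i) (suc j) h = members-disjoint M i j (h ∘ cong suc)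

-- P may be empty, which is why it is kept apart from the other sets.
Matching⇒HasMatching : ∀ {n s} {F : Family n} {Z P U} → Split Z P U → T (F P) → Matching F s U → HasMatching F (suc s)
Matching⇒HasMatching {n} {s} {F} {Z} {P} p FP M = f , f∈ , λ i j h → f≢ i j h , f∩ i j h
  where
  f : Fin (suc s) → Subset n
  f zero = P
  f (suc i) = members M i
  f∈ : ∀ i → T (F (f i))
  f∈ zero = FP
  f∈ (suc i) = members-∈ M i
  f∩ : ∀ i j → i ≢ j → f i ∩ f j ≡ ⊥
  f∩ zero zero h = ⊥-elim (h refl)
  f∩ zero (suc j) h = Split-disjoint p (proj₂ (members-⊆ M j))
  f∩ (suc i) zero h = trans (∩-comm _ P) (Split-disjoint p (proj₂ (members-⊆ M i)))
  f∩ (suc i) (suc j) h = members-disjoint M i j (h ∘ cong suc)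
  f≢ : ∀ i j → i ≢ j → f i ≢ f j
  f≢ zero zero h = λ _ → h refl
  f≢ (suc i) j h = disjoint⇒≢ (f∩ (suc i) j h) (members-nonempty M i)
  f≢ zero (suc j) h e = disjoint⇒≢ (f∩ (suc j) zero (h ∘ sym)) (members-nonempty M j) (sym e)

-- Segments as extreme sets of the shifting order

seg : ℕ → ℕ → ∀ n → Subset n
seg X w zero = []
seg (suc X) w (suc n) = false ∷ seg X w n
seg zero (suc w) (suc n) = true ∷ seg zero w n
seg zero zero (suc n) = false ∷ seg zero zero n

#-seg : ∀ X w n → X + w ≤ n → # (seg X w n) ≡ w
#-seg zero zero zero p = refl
#-seg (suc X) w (suc n) (s≤s p) = #-seg X w n p
#-seg zero (suc w) (suc n) (s≤s p) = cong suc (#-seg zero w n p)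
#-seg zero zero (suc n) p = #-seg zero zero n z≤n

lo-seg : ∀ X w n → lo X (seg X w n) ≡ 0
lo-seg zero w n = refl
lo-seg (suc X) w zero = refl
lo-seg (suc X) w (suc n) = lo-seg X w n

-- For `d = 0`: `seg X w n` is the lowest of the `w`-sets that avoid the first `X` points.
Dom-seg-below : ∀ {n} d X w (A : Subset n) → # A ≡ d + w → lo X A ≡ 0 → Dom d A (seg X w n) 0
Dom-seg-below zero X w [] e l = []
Dom-seg-below d (suc X) w (false ∷ A) e l = same false (Dom-seg-below d X w A e l)
Dom-seg-below d zero zero (false ∷ A) e l = same false (Dom-seg-below d zero zero A e l)
Dom-seg-below d zero (suc w) (false ∷ A) e l = gain (Dom-seg-below (suc d) zero w A (trans e (+-suc d w)) l)
Dom-seg-below d zero (suc w) (true ∷ A) e l = same true (Dom-seg-below d zero w A (suc-injective (trans e (+-suc d w))) l)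
Dom-seg-below (suc d) zero zero (true ∷ A) e l = lose (Dom-seg-below d zero zero A (suc-injective e) l)

-- `A` collects its points below `D` before `E` has any, and these together with the initial lead
-- already pay for all of `E`.
Dom-threshold : ∀ {n} d e D (E A : Subset n) → lo D E ≡ 0 → # E ≤ d + lo D A → d + # A ≡ # E + e → Dom d E A e
Dom-threshold d e D [] [] l h q = subst (Dom d [] []) (trans (sym (+-identityʳ d)) q) []
Dom-threshold d e (suc D) (false ∷ E) (false ∷ A) l h q = same false (Dom-threshold d e D E A l h q)
Dom-threshold d e (suc D) (false ∷ E) (true ∷ A) l h q =
  gain (Dom-threshold (suc d) e D E A l (subst (# E ≤_) (+-suc d _) h) (trans (sym (+-suc d _)) q))
Dom-threshold d e zero (false ∷ E) (false ∷ A) l h q = same false (Dom-threshold d e zero E A l h q)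
Dom-threshold d e zero (false ∷ E) (true ∷ A) l h q =
  gain (Dom-threshold (suc d) e zero E A l (m≤n⇒m≤1+n h) (trans (sym (+-suc d _)) q))
Dom-threshold d e zero (true ∷ E) (true ∷ A) l h q =
  same true (Dom-threshold d e zero E A l (≤-trans (n≤1+n _) h) (suc-injective (trans (sym (+-suc d _)) q)))
Dom-threshold (suc d) e zero (true ∷ E) (false ∷ A) l (s≤s h) q = lose (Dom-threshold d e zero E A l h (suc-injective q))

-- For `d = 0`: `seg y w n` is the highest `w`-set inside the first `y + w` points, so its presence
-- forces all the others.
Dom-seg-above : ∀ {n} d y w (A : Subset n) → y + w ≤ n → w ≡ d + # A → lo (y + w) A ≡ # A → Dom d (seg y w n) A 0
Dom-seg-above zero zero zero [] p e l = []
Dom-seg-above d (suc y) w (false ∷ A) (s≤s p) e l = same false (Dom-seg-above d y w A p e l)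
Dom-seg-above d (suc y) w (true ∷ A) (s≤s p) e l = gain (Dom-seg-above (suc d) y w A p (trans e (+-suc d _)) (suc-injective l))
Dom-seg-above d zero zero (false ∷ A) p e l = same false (Dom-seg-above d zero zero A z≤n e (sym (m+n≡0⇒n≡0 d (sym e))))
Dom-seg-above d zero zero (true ∷ A) p e l = ⊥-elim (0≢1+n (trans e (+-suc d _)))
Dom-seg-above d zero (suc w) (true ∷ A) (s≤s p) e l =
  same true (Dom-seg-above d zero w A p (suc-injective (trans e (+-suc d _))) (suc-injective l))
Dom-seg-above zero zero (suc w) (false ∷ A) (s≤s p) e l = ⊥-elim (<⇒≱ (≤-reflexive e) (subst (_≤ w) l (lo≤ w A)))
Dom-seg-above (suc d) zero (suc w) (false ∷ A) (s≤s p) e l = lose (Dom-seg-above d zero w A p (suc-injective e) l)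

AllBelow : ∀ {n} → ℕ → ℕ → Family n → Set
AllBelow w q G = ∀ A → # A ≡ w → lo q A ≡ w → T (G A)

seg⇒AllBelow : ∀ {n} {G : Family n} y w → DomClosed G → y + w ≤ n → T (G (seg y w n)) → AllBelow w (y + w) G
seg⇒AllBelow y w cl p h A e e′ = cl (Dom-seg-above 0 y w A p (sym e) (trans e′ (sym e))) h

split-lo-≤ : ∀ {n} j {U A V : Subset n} {a} → Split U A V → # A ≤ a → lo j U ≤ a + lo j V
split-lo-≤ j {A = A} {V} p h = ≤-trans (≤-reflexive (lo-Split j p)) (+-monoˡ-≤ (lo j V) (≤-trans (lo≤# j A) h))

-- The continuation builds the rest of the matching. It is told how many points remain below every
-- `j`, since the next stage may use another threshold.
repeat : ∀ {n p} {G : Family n} w q → 1 ≤ w → AllBelow w q G → ∀ a V → a * w ≤ lo q V →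
         (∀ V′ → (∀ j → lo j V ≤ a * w + lo j V′) → Matching G p V′) → Matching G (a + p) V
repeat w q w≥1 ab zero V h k = k V λ j → ≤-refl
repeat w q w≥1 ab (suc a) V h k with take q w 0 V (≤-trans (m≤m+n w (a * w)) h) z≤n
... | A , V₁ , s , eA , eh = add s (subst (1 ≤_) (sym #A) w≥1) (ab A #A eA)
      (repeat w q w≥1 ab a V₁ (+-cancelˡ-≤ w _ _ (≤-trans h (split-lo-≤ q s (≤-reflexive #A))))
        λ V′ h′ → k V′ λ j → ≤-trans (split-lo-≤ j s (≤-reflexive #A)) (≤-trans (+-monoʳ-≤ w (h′ j)) (≤-reflexive (sym (+-assoc w (a * w) _)))))
  where
  #A : # A ≡ w
  #A = trans (sym (lo+hi q A)) (trans (cong₂ _+_ eA eh) (+-identityʳ w))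

singles : ∀ {n} {G : Family n} q → AllBelow 1 q G → ∀ a V → a ≤ lo q V → Matching G a V
singles {G = G} q ab a V h = subst (λ z → Matching G z V) (+-identityʳ a)
  (repeat 1 q (s≤s z≤n) ab a V (subst (_≤ lo q V) (sym (*-identityʳ a)) h) λ _ _ → [])

singles-pairs : ∀ {n} {G : Family n} q z → AllBelow 1 q G → AllBelow 2 z G → ∀ a p V → a ≤ lo q V → a + p * 2 ≤ lo z V → Matching G (a + p) V
singles-pairs {G = G} q z ab₁ ab₂ a p V h h′ =
  repeat 1 q (s≤s z≤n) ab₁ a V (subst (_≤ lo q V) (sym (*-identityʳ a)) h) λ V₁ k →
    subst (λ x → Matching G x V₁) (+-identityʳ p) 
      (repeat 2 z (s≤s z≤n) ab₂ p V₁ (+-cancelˡ-≤ a _ _ (≤-trans h′ (subst (λ x → lo z V ≤ x + lo z V₁) (*-identityʳ a) (k z)))) λ _ _ → [])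

-- Greedy completion of a matching

module Greedy {N K : ℕ} (w X D : ℕ) (F : Family (N + suc K)) (closed : DomClosed F) (D+w≤N : D + w ≤ N) (X+w≤N : X + w ≤ N)
              (strong : T (F (seg D w N ++ (true ∷ ⊥)))) where

  -- The sets S in the link are the present ones: any w points below X may replace seg X w N.
  link : Family (suc K)
  link S = F (seg X w N ++ S)

  -- `A` has one point more than `seg D w N`; it makes up for the point after the prefix that the
  -- set in `strong` contains.
  low-class : ∀ (A : Subset N) → w ≤ lo D A → # A ≡ suc w → T (F (A ++ ⊥))
  low-class A h e = closed (Dom-++ (Dom-threshold 0 1 D (seg D w N) A (lo-seg D w N) (subst (_≤ lo D A) (sym #s) h)
      (trans e (trans (sym (+-comm w 1)) (cong (_+ 1) (sym #s))))) (lose (Dom-refl ⊥))) strong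
    where #s = #-seg D w N D+w≤N

  -- Each set takes a point above D as long as there is one; this keeps both hypotheses invariant.
  fill : ∀ q (U : Subset N) (V : Subset (suc K)) → q * w ≤ lo D U → q * suc w ≤ # U → Matching F q (U ++ V)
  fill zero U V h h′ = []
  fill (suc q) U V h h′ with hi D U in eq
  -- All of `U` now lies below `D`, so the bound on `# U` is a bound on `lo D U` and a whole set
  -- fits there.
  ... | zero with take D (suc w) 0 U (≤-trans (m≤m+n (suc w) (q * suc w)) (≤-trans h′ (≤-reflexive #U))) z≤n
    where
    #U : # U ≡ lo D U
    #U = trans (sym (lo+hi D U)) (trans (cong (lo D U +_) eq) (+-identityʳ _))
  ... | A , U₁ , s , eA , eh = add (Split-++ s (Split-none V)) (subst (1 ≤_) (sym (#-++ A ⊥)) (≤-trans (subst (1 ≤_) (sym #A) (s≤s z≤n)) (m≤m+n (# A) _)))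
        (low-class A (subst (w ≤_) (sym eA) (n≤1+n w)) #A) (fill q U₁ V (≤-trans (*-monoʳ-≤ q (n≤1+n w)) lo₁) (≤-trans lo₁ (lo≤# D U₁)))
    where
    #A : # A ≡ suc w
    #A = trans (sym (lo+hi D A)) (trans (cong₂ _+_ eA eh) (+-identityʳ _))
    #U : # U ≡ lo D U
    #U = trans (sym (lo+hi D U)) (trans (cong (lo D U +_) eq) (+-identityʳ _))
    lo₁ : q * suc w ≤ lo D U₁
    lo₁ = +-cancelˡ-≤ (suc w) _ _ (≤-trans h′ (≤-trans (≤-reflexive #U) (split-lo-≤ D s (≤-reflexive #A))))
  fill (suc q) U V h h′ | suc _ with take D w 1 U (≤-trans (m≤m+n w (q * w)) h) (subst (1 ≤_) (sym eq) (s≤s z≤n))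
  ... | A , U₁ , s , eA , eh = add (Split-++ s (Split-none V)) (subst (1 ≤_) (sym (#-++ A ⊥)) (≤-trans (subst (1 ≤_) (sym #A) (s≤s z≤n)) (m≤m+n (# A) _)))
        (low-class A (≤-reflexive (sym eA)) #A)
        (fill q U₁ V (+-cancelˡ-≤ w _ _ (≤-trans h (≤-reflexive (trans (lo-Split D s) (cong (_+ lo D U₁) eA)))))
                     (+-cancelˡ-≤ (suc w) _ _ (≤-trans h′ (≤-reflexive (trans (#-Split s) (cong (_+ # U₁) #A))))))
    where
    #A : # A ≡ suc w
    #A = trans (sym (lo+hi D A)) (trans (cong₂ _+_ eA eh) (+-comm w 1))

  -- Each link member is completed by `w` free points below `X`, then `fill` supplies `q` more sets.
  -- The three bounds count the points needed below `X`, below `D` and in the whole prefix.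
  lift-matching : ∀ {g} q (U : Subset N) {V} → Matching link g V → g * w ≤ lo X U → (g + q) * w ≤ lo D U → g * w + q * suc w ≤ # U →
                  Matching F (g + q) (U ++ V)
  lift-matching q U [] h₁ h₂ h₃ = fill q U _ h₂ h₃
  lift-matching {suc g} q U (add {A = S} p S≥1 GS M) h₁ h₂ h₃ with take X w 0 U (≤-trans (m≤m+n w (g * w)) h₁) z≤n
  ... | A , U₁ , s , eA , eh = add (Split-++ s p) (subst (1 ≤_) (sym (#-++ A S)) (≤-trans S≥1 (m≤n+m (# S) (# A))))
        (closed (Dom-++ (Dom-threshold 0 0 X (seg X w N) A (lo-seg X w N) (≤-reflexive (trans #s (sym eA))) (trans #A (trans (sym #s) (sym (+-identityʳ _))))) (Dom-refl S)) GS)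
        (lift-matching q U₁ M (+-cancelˡ-≤ w _ _ (≤-trans h₁ (split-lo-≤ X s (≤-reflexive #A))))
                              (+-cancelˡ-≤ w _ _ (≤-trans h₂ (split-lo-≤ D s (≤-reflexive #A))))
                              (+-cancelˡ-≤ w _ _ (≤-trans (≤-reflexive (sym (+-assoc w (g * w) _))) (≤-trans h₃ (≤-reflexive (trans (#-Split s) (cong (_+ # U₁) #A)))))))
    where
    #s = #-seg X w N X+w≤N
    #A : # A ≡ w
    #A = trans (sym (lo+hi X A)) (trans (cong₂ _+_ eA eh) (+-identityʳ w))

  extend : ∀ {g} q (PL : Subset N) {PH V} → T (F (PL ++ PH)) → Split full PH V → Matching link g V →
           # PL + g * w ≤ X → # PL + (g + q) * w ≤ D → # PL + (g * w + q * suc w) ≤ N → HasMatching F (suc (g + q))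
  extend {g} q PL FP p M h₁ h₂ h₃ with complement-Split PL
  ... | U , s = Matching⇒HasMatching (Split-++ s p) FP
        (lift-matching q U M (bound X h₁ (≤-trans (m≤m+n X w) X+w≤N)) (bound D h₂ (≤-trans (m≤m+n D w) D+w≤N))
          (+-cancelˡ-≤ (# PL) _ _ (≤-trans h₃ (≤-reflexive (trans (sym (lo-full {N} N ≤-refl)) (trans (#≡lo {N} full) (#-Split s)))))))
    where
    bound : ∀ j {x} → # PL + x ≤ j → j ≤ N → x ≤ lo j U
    bound j h j≤N = +-cancelˡ-≤ (# PL) _ _ (≤-trans h (≤-trans (≤-reflexive (sym (lo-full j j≤N))) (split-lo-≤ j s ≤-refl)))

-- Counting

binom : ℕ → ℕ → ℕ
binom n zero = 1
binom zero (suc k) = 0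
binom (suc n) (suc k) = binom n k + binom n (suc k)

-- The number of sets with fewer than `k` elements, the volume of a Hamming ball.
ball : ℕ → ℕ → ℕ
ball n zero = 0
ball n (suc k) = ball n k + binom n k

sumOver-0 : ∀ n → sumOver {n} (λ _ → 0) ≡ 0
sumOver-0 zero = refl
sumOver-0 (suc n) = cong₂ _+_ (sumOver-0 n) (sumOver-0 n)

δ : ∀ {n} → Subset n → Subset n → ℕ
δ [] [] = 1
δ (true ∷ A) (true ∷ B) = δ A B
δ (false ∷ A) (false ∷ B) = δ A B
δ (true ∷ A) (false ∷ B) = 0
δ (false ∷ A) (true ∷ B) = 0

sumOver-δ : ∀ {n} (A : Subset n) → sumOver (δ A) ≡ 1
sumOver-δ [] = refl
sumOver-δ {suc n} (true ∷ A) = cong₂ _+_ (sumOver-0 n) (sumOver-δ A)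
sumOver-δ {suc n} (false ∷ A) = cong₂ _+_ (sumOver-δ A) (sumOver-0 n)

δ-cases : ∀ {n} (A B : Subset n) → δ A B ≡ 0 ⊎ (δ A B ≡ 1 × A ≡ B)
δ-cases [] [] = inj₂ (refl , refl)
δ-cases (true ∷ A) (true ∷ B) with δ-cases A B
... | inj₁ e = inj₁ e
... | inj₂ (e , refl) = inj₂ (e , refl)
δ-cases (false ∷ A) (false ∷ B) with δ-cases A B
... | inj₁ e = inj₁ e
... | inj₂ (e , refl) = inj₂ (e , refl)
δ-cases (true ∷ A) (false ∷ B) = inj₁ refl
δ-cases (false ∷ A) (true ∷ B) = inj₁ refl

multiplicity : ∀ {n} → List (Subset n) → Subset n → ℕ
multiplicity [] P = 0
multiplicity (A ∷ As) P = δ A P + multiplicity As P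

sumOver-multiplicity : ∀ {n} (As : List (Subset n)) → sumOver (multiplicity As) ≡ length As
sumOver-multiplicity {n} [] = sumOver-0 n
sumOver-multiplicity (A ∷ As) = trans (sumOver-+ (δ A) (multiplicity As)) (cong₂ _+_ (sumOver-δ A) (sumOver-multiplicity As))

multiplicity-0 : ∀ {n} {P : Subset n} {As} → All (P ≢_) As → multiplicity As P ≡ 0
multiplicity-0 [] = refl
multiplicity-0 {P = P} {A ∷ As} (ne ∷ h) with δ-cases A P
... | inj₁ e = cong₂ _+_ e (multiplicity-0 h)
... | inj₂ (_ , e) = ⊥-elim (ne (sym e))

multiplicity-≤ : ∀ {n} (F : Family n) {As} → Unique As → All (λ A → ¬ T (F A)) As → ∀ P → multiplicity As P ≤ bit (not (F P))
multiplicity-≤ F [] [] P = z≤n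
multiplicity-≤ F {A ∷ As} (u ∷ us) (h ∷ hs) P with δ-cases A P
... | inj₁ e = subst (λ z → z + multiplicity As P ≤ bit (not (F P))) (sym e) (multiplicity-≤ F us hs P)
... | inj₂ (e , refl) = subst₂ (λ x y → x + y ≤ bit (not (F A))) (sym e) (sym (multiplicity-0 u)) (absent (F A) h)
  where
  absent : ∀ x → ¬ T x → 1 ≤ bit (not x)
  absent true h = ⊥-elim (h tt)
  absent false h = s≤s z≤n

-- The number of absent sets will be bounded from below by listing distinct ones.
length≤count : ∀ {n} (F : Family n) {As} → Unique As → All (λ A → ¬ T (F A)) As → length As ≤ count (not ∘ F)
length≤count F {As} u h = subst (_≤ count (not ∘ F)) (sumOver-multiplicity As) (sumOver-mono (multiplicity-≤ F u h))

sumOver-level : ∀ n w → sumOver {n} (λ P → bit (# P ≡ᵇ w)) ≡ binom n w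
sumOver-level zero zero = refl
sumOver-level zero (suc w) = refl
sumOver-level (suc n) zero = cong₂ _+_ (sumOver-level n zero) (sumOver-0 n)
sumOver-level (suc n) (suc w) = trans (+-comm (sumOver {n} _) _) (cong₂ _+_ (sumOver-level n w) (sumOver-level n (suc w)))

sumOver-ball : ∀ n w → sumOver {n} (λ P → bit (# P <ᵇ w)) ≡ ball n w
sumOver-ball n zero = sumOver-0 n
sumOver-ball n (suc w) = trans (trans (sumOver-cong {n} λ P → split (# P) w) (sumOver-+ {n} _ _)) (cong₂ _+_ (sumOver-ball n w) (sumOver-level n w))
  where
  split : ∀ a w → bit (a <ᵇ suc w) ≡ bit (a <ᵇ w) + bit (a ≡ᵇ w)
  split zero zero = refl
  split zero (suc w) = refl
  split (suc a) zero = refl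
  split (suc a) (suc w) = split a w

sumOver-≤1 : ∀ n → sumOver {n} (λ P → bit (# P <ᵇ 2)) ≡ suc n
sumOver-≤1 zero = refl
sumOver-≤1 (suc n) = trans (cong₂ _+_ (sumOver-≤1 n) (trans (sumOver-ball n 1) refl)) (+-comm (suc n) 1)

-- The indicator of the `w`-sets that avoid the first `X` points.
above : ℕ → ℕ → ∀ {n} → Subset n → ℕ
above zero w A = bit (# A ≡ᵇ w)
above (suc X) w [] = bit (0 ≡ᵇ w)
above (suc X) w (true ∷ A) = 0
above (suc X) w (false ∷ A) = above X w A

above-cases : ∀ X w {n} (A : Subset n) → above X w A ≡ 0 ⊎ (above X w A ≡ 1 × # A ≡ w × lo X A ≡ 0)
above-cases zero w A with # A ≡ᵇ w in eq
... | true = inj₂ (refl , ≡ᵇ⇒≡ (# A) w (subst T (sym eq) tt) , refl)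
... | false = inj₁ refl
above-cases (suc X) zero [] = inj₂ (refl , refl , refl)
above-cases (suc X) (suc w) [] = inj₁ refl
above-cases (suc X) w (true ∷ A) = inj₁ refl
above-cases (suc X) w (false ∷ A) = above-cases X w A

sumOver-above : ∀ X w n → sumOver {n} (above X w) ≡ binom (n ∸ X) w
sumOver-above zero w n = sumOver-level n w
sumOver-above (suc X) zero zero = refl
sumOver-above (suc X) (suc w) zero = refl
sumOver-above (suc X) w (suc n) = trans (cong₂ _+_ (sumOver-above X w n) (sumOver-0 n)) (+-identityʳ _)

-- If `S` is absent from the link, then `A ++ S` is absent from `F` for every `w`-set `A` beyond
-- `X`, because `A` shifts to `seg X w N`.
count-link : ∀ {N K} X w (F : Family (N + K)) → DomClosed F →
             binom (N ∸ X) w * count (λ S → not (F (seg X w N ++ S))) ≤ count (not ∘ F)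
count-link {N} {K} X w F cl = begin
  binom (N ∸ X) w * c                   ≡⟨ cong (_* c) (sym (sumOver-above X w N)) ⟩
  sumOver (above X w {N}) * c           ≡⟨ sym (sumOver-* (above X w {N}) c) ⟩
  sumOver {N} (λ A → above X w A * c)   ≤⟨ sumOver-mono pointwise ⟩
  sumOver {N} (λ A → sumOver (λ S → bit (not (F (A ++ S))))) ≡⟨ sym (sumOver-++ N _) ⟩
  count (not ∘ F) ∎
  where
  open ≤-Reasoning
  c = count (λ S → not (F (seg X w N ++ S)))
  not-mono : ∀ x y → (T x → T y) → T (not y) → T (not x)
  not-mono true true _ ()
  not-mono true false h _ = ⊥-elim (h tt)
  not-mono false _ _ _ = tt
  pointwise : ∀ (A : Subset N) → above X w A * c ≤ sumOver (λ S → bit (not (F (A ++ S))))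
  pointwise A with above-cases X w A
  ... | inj₁ e = subst (λ z → z * c ≤ _) (sym e) z≤n
  ... | inj₂ (e , e₁ , e₂) = subst (λ z → z * c ≤ _) (sym e) (≤-trans (≤-reflexive (+-identityʳ c))
        (count-mono (λ S → not (F (seg X w N ++ S))) (λ S → not (F (A ++ S))) λ S →
          not-mono (F (A ++ S)) (F (seg X w N ++ S)) (cl (Dom-++ (Dom-seg-below 0 X w A e₁ e₂) (Dom-refl S)))))

-- The sizes of the two extremal families

≤ᵇ-true : ∀ {a b} → a ≤ b → (a ≤ᵇ b) ≡ true
≤ᵇ-true h = Equivalence.to T-≡ (≤⇒≤ᵇ h)

≤ᵇ-false : ∀ {a b} → b < a → (a ≤ᵇ b) ≡ false
≤ᵇ-false {a} {b} h with a ≤ᵇ b in eq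
... | false = refl
... | true = ⊥-elim (<⇒≱ h (≤ᵇ⇒≤ a b (subst T (sym eq) tt)))

<ᵇ-true : ∀ {a b} → a < b → (a <ᵇ b) ≡ true
<ᵇ-true h = Equivalence.to T-≡ (<⇒<ᵇ h)

≡ᵇ-refl : ∀ a → (a ≡ᵇ a) ≡ true
≡ᵇ-refl a = Equivalence.to T-≡ (≡⇒≡ᵇ a a refl)

-- With `t = 2 * m` and `a = m * s ∸ c ∸ 1` this is `Q`.
heavy : ∀ {n} → ℕ → ℕ → Family n
heavy t a P = t ≤ᵇ # P + lo a P

weight-++ : ∀ {N R} (A : Subset N) (S : Subset R) → # (A ++ S) + lo N (A ++ S) ≡ # A + # S + # A
weight-++ {N} A S = cong₂ _+_ (#-++ A S) (trans (cong (λ z → lo z (A ++ S)) (sym (+-identityʳ N))) (trans (lo-++ A S 0) (+-identityʳ _)))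

weight-above-level : ∀ w a s → w < a → 2 * suc w ≤ a + s + a
weight-above-level w a s h = ≤-by s (+-mono-≤ h h) (solve (w ∙ a ∙ s ∙ ε))

weight-at-level : ∀ w s → 2 ≤ s → 2 * suc w ≤ w + s + w
weight-at-level w s h = ≤-by 0 h (solve (w ∙ s ∙ ε))

-- By `weight-++`, a light set has at most `w` points in the prefix. With exactly `w` it has at most
-- one of the last `R` points; with fewer, every subset of these is allowed for.
count-light : ∀ N R w → count {N + R} (not ∘ heavy (2 * suc w) N) ≤ binom N w * suc R + ball N w * sumOver {R} (λ _ → 1)
count-light N R w = begin
  count {N + R} (not ∘ heavy (2 * suc w) N)   ≡⟨ sumOver-++ N (bit ∘ not ∘ heavy {N + R} (2 * suc w) N) ⟩
  sumOver {N} (λ A → light A)         ≤⟨ sumOver-mono pointwise ⟩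
  sumOver {N} (λ A → bit (# A ≡ᵇ w) * suc R + bit (# A <ᵇ w) * p)   ≡⟨ sumOver-+ {N} _ _ ⟩
  sumOver {N} (λ A → bit (# A ≡ᵇ w) * suc R) + sumOver {N} (λ A → bit (# A <ᵇ w) * p)
    ≡⟨ cong₂ _+_ (trans (sumOver-* {N} _ (suc R)) (cong (_* suc R) (sumOver-level N w)))
                  (trans (sumOver-* {N} _ p) (cong (_* p) (sumOver-ball N w))) ⟩
  binom N w * suc R + ball N w * p ∎
  where
  open ≤-Reasoning
  p = sumOver {R} (λ _ → 1)
  light : Subset N → ℕ
  light A = sumOver {R} (λ S → bit (not (heavy (2 * suc w) N (A ++ S))))
  at-level : ∀ s → bit (not (2 * suc w ≤ᵇ w + s + w)) ≤ bit (s <ᵇ 2)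
  at-level 0 = bit≤1 _
  at-level 1 = bit≤1 _
  at-level (suc (suc s)) = ≤-reflexive (cong (bit ∘ not) (≤ᵇ-true (weight-at-level w (2 + s) (s≤s (s≤s z≤n)))))
  pointwise : ∀ A → light A ≤ bit (# A ≡ᵇ w) * suc R + bit (# A <ᵇ w) * p
  pointwise A with <-cmp (# A) w
  ... | tri< lt _ _ = ≤-trans (sumOver-mono {R} λ S → bit≤1 _)
        (≤-trans (≤-reflexive (trans (sym (+-identityʳ p)) (cong (λ z → bit z * p) (sym (<ᵇ-true lt))))) (m≤n+m _ (bit (# A ≡ᵇ w) * suc R)))
  ... | tri> _ _ gt = ≤-trans (sumOver-mono {R} λ S → ≤-reflexive (cong (bit ∘ not)
          (trans (cong (2 * suc w ≤ᵇ_) (weight-++ A S)) (≤ᵇ-true (weight-above-level w (# A) (# S) gt)))))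
        (≤-trans (≤-reflexive (sumOver-0 R)) z≤n)
  ... | tri≈ _ e _ = ≤-trans (sumOver-mono {R} λ S → subst (λ z → bit (not z) ≤ bit (# S <ᵇ 2))
          (trans (cong (λ z → 2 * suc w ≤ᵇ z + # S + z) (sym e)) (cong (2 * suc w ≤ᵇ_) (sym (weight-++ A S)))) (at-level (# S)))
        (≤-trans (≤-reflexive (trans (sumOver-≤1 R) (trans (sym (+-identityʳ (suc R)))
            (cong (λ z → bit z * suc R) (sym (trans (cong (_≡ᵇ w) e) (≡ᵇ-refl w)))))))
          (m≤m+n _ (bit (# A <ᵇ w) * p)))

-- The families differ only on sets with exactly `w` points in the prefix. There one asks for the
-- first of the last three points and the other for at least two of the three; each holds for four
-- of the eight subsets.
count-lower≡heavy : ∀ N w → count {N + 3} (λ P → suc w ≤ᵇ lo (N + 1) P) ≡ count {N + 3} (heavy (2 * suc w) N)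
count-lower≡heavy N w = trans (sumOver-++ N _) (trans (sumOver-cong {N} pointwise) (sym (sumOver-++ N _)))
  where
  light : ∀ w a s → a < w → s ≤ 3 → a + s + a < 2 * suc w
  light w a s h h′ = ≤-by 0 (+-mono-≤ (+-mono-≤ h h) h′) (solve (w ∙ a ∙ s ∙ ε))
  one : ∀ w s → s < 2 → w + s + w < 2 * suc w
  one w s h = ≤-by 0 h (solve (w ∙ s ∙ ε))
  at-level : ∀ s → (2 * suc w ≤ᵇ w + s + w) ≡ (2 ≤ᵇ s)
  at-level 0 = ≤ᵇ-false (one w 0 (s≤s z≤n))
  at-level 1 = ≤ᵇ-false (one w 1 (s≤s (s≤s z≤n)))
  at-level (suc (suc s)) = ≤ᵇ-true (weight-at-level w (2 + s) (s≤s (s≤s z≤n)))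
  H = λ (A : Subset N) (S : Subset 3) → heavy (2 * suc w) N (A ++ S)
  L = λ (A : Subset N) (S : Subset 3) → suc w ≤ᵇ lo (N + 1) (A ++ S)
  first : Subset 3 → ℕ
  first S = bit (1 ≤ᵇ lo 1 S)
  pointwise : ∀ A → sumOver {3} (λ S → bit (L A S)) ≡ sumOver {3} (λ S → bit (H A S))
  pointwise A with <-cmp (# A) w
  ... | tri< lt _ _ = trans (sumOver-cong {3} λ S → cong bit (trans (cong (suc w ≤ᵇ_) (lo-++ A S 1))
          (≤ᵇ-false (s≤s (≤-trans (+-monoʳ-≤ (# A) (lo≤ 1 S)) (subst (_≤ w) (+-comm 1 (# A)) lt))))))
        (sym (sumOver-cong {3} λ S → cong bit (trans (cong (2 * suc w ≤ᵇ_) (weight-++ A S)) (≤ᵇ-false (light w (# A) (# S) lt (subst (_≤ 3) (#≡lo S) (lo≤ 3 S)))))))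
  ... | tri> _ _ gt = trans (sumOver-cong {3} λ S → cong bit (trans (cong (suc w ≤ᵇ_) (lo-++ A S 1)) (≤ᵇ-true (≤-trans gt (m≤m+n _ _)))))
        (sym (sumOver-cong {3} λ S → cong bit (trans (cong (2 * suc w ≤ᵇ_) (weight-++ A S)) (≤ᵇ-true (weight-above-level w (# A) (# S) gt)))))
  ... | tri≈ _ e _ = trans (sumOver-cong {3} {h = first} λ S → cong bit (trans (cong (suc w ≤ᵇ_) (lo-++ A S 1))
          (trans (cong (λ z → suc w ≤ᵇ z + lo 1 S) e) (level₁ (lo 1 S)))))
        (sym (sumOver-cong {3} λ S → cong bit (trans (cong (2 * suc w ≤ᵇ_) (weight-++ A S)) (trans (cong (λ z → 2 * suc w ≤ᵇ z + # S + z) e) (at-level (# S))))))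
    where
    level₁ : ∀ s → (suc w ≤ᵇ w + s) ≡ (1 ≤ᵇ s)
    level₁ zero = ≤ᵇ-false (s≤s (≤-reflexive (+-identityʳ w)))
    level₁ (suc s) = ≤ᵇ-true (≤-trans (s≤s (m≤m+n w s)) (≤-reflexive (sym (+-suc w s))))

-- Weight bounds for matchings

sumFin : ∀ s → (Fin s → ℕ) → ℕ
sumFin zero f = 0
sumFin (suc s) f = f zero + sumFin s (f ∘ suc)

sumFin-+ : ∀ s (f g : Fin s → ℕ) → sumFin s (λ i → f i + g i) ≡ sumFin s f + sumFin s g
sumFin-+ zero f g = refl
sumFin-+ (suc s) f g = trans (cong (f zero + g zero +_) (sumFin-+ s (f ∘ suc) (g ∘ suc))) (interchange (f zero) (g zero) (sumFin s (f ∘ suc)) _)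

sumFin-const : ∀ s t (f : Fin s → ℕ) → (∀ i → t ≤ f i) → s * t ≤ sumFin s f
sumFin-const zero t f h = z≤n
sumFin-const (suc s) t f h = +-mono-≤ (h zero) (sumFin-const s t (f ∘ suc) (h ∘ suc))

sumFin-0 : ∀ s (f : Fin s → ℕ) → (∀ i → f i ≡ 0) → sumFin s f ≡ 0
sumFin-0 zero f h = refl
sumFin-0 (suc s) f h = cong₂ _+_ (h zero) (sumFin-0 s (f ∘ suc) (h ∘ suc))

sumFin-cong : ∀ s {f g : Fin s → ℕ} → (∀ i → f i ≡ g i) → sumFin s f ≡ sumFin s g
sumFin-cong zero h = refl
sumFin-cong (suc s) h = cong₂ _+_ (h zero) (sumFin-cong s (h ∘ suc))

sumFin-exclusive : ∀ s (h : Fin s → Bool) → (∀ i j → i ≢ j → h i ∧ h j ≡ false) → sumFin s (bit ∘ h) ≤ 1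
sumFin-exclusive zero h e = z≤n
sumFin-exclusive (suc s) h e with h zero in eq
... | false = sumFin-exclusive s (h ∘ suc) λ i j ne → e (suc i) (suc j) (ne ∘ Fin.suc-injective)
... | true = s≤s (≤-reflexive (sumFin-0 s _ λ i → cong bit (trans (cong (_∧ h (suc i)) (sym eq)) (e zero (suc i) λ ()))))

sumFin-lo : ∀ {n} s a (f : Fin s → Subset n) → (∀ i j → i ≢ j → f i ∩ f j ≡ ⊥) → sumFin s (lo a ∘ f) ≤ a
sumFin-lo s zero f dis = ≤-reflexive (sumFin-0 s _ λ _ → refl)
sumFin-lo {zero} s (suc a) f dis = ≤-trans (≤-reflexive (sumFin-0 s _ λ i → nil (f i))) z≤n
  where
  nil : ∀ (A : Subset 0) → lo (suc a) A ≡ 0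
  nil [] = refl
sumFin-lo {suc n} s (suc a) f dis = ≤-trans (≤-reflexive (trans (sumFin-cong s λ i → uncons (f i)) (sumFin-+ s _ _)))
    (+-mono-≤ (sumFin-exclusive s (head ∘ f) λ i j ne → trans (sym (head-∩ (f i) (f j))) (cong head (dis i j ne)))
              (sumFin-lo s a (tail ∘ f) λ i j ne → trans (sym (tail-∩ (f i) (f j))) (cong tail (dis i j ne))))
  where
  uncons : ∀ (A : Subset (suc n)) → lo (suc a) A ≡ bit (head A) + lo a (tail A)
  uncons (x ∷ A) = refl
  head-∩ : ∀ (A B : Subset (suc n)) → head (A ∩ B) ≡ head A ∧ head B
  head-∩ (x ∷ A) (y ∷ B) = refl
  tail-∩ : ∀ (A B : Subset (suc n)) → tail (A ∩ B) ≡ tail A ∩ tail B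
  tail-∩ (x ∷ A) (y ∷ B) = refl

-- The weights of disjoint sets add up to at most the weight of the ground set.
HasMatching-weight : ∀ {n s} t a (F : Family n) → (∀ P → T (F P) → t ≤ # P + lo a P) → HasMatching F s → s * t ≤ n + a
HasMatching-weight {n} {s} t a F h (f , f∈ , dis) = ≤-trans (sumFin-const s t _ (λ i → h (f i) (f∈ i)))
  (≤-trans (≤-reflexive (trans (sumFin-+ s _ _) (cong (_+ sumFin s (lo a ∘ f)) (sumFin-cong s λ i → sym (#≡lo (f i))))))
    (+-mono-≤ (sumFin-lo s n f λ i j ne → proj₂ (dis i j ne)) (sumFin-lo s a f λ i j ne → proj₂ (dis i j ne))))

HasMatching-lo : ∀ {n s} t a (F : Family n) → (∀ P → T (F P) → t ≤ lo a P) → HasMatching F s → s * t ≤ a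
HasMatching-lo {n} {s} t a F h (f , f∈ , dis) =
  ≤-trans (sumFin-const s t _ (λ i → h (f i) (f∈ i))) (sumFin-lo s a f λ i j ne → proj₂ (dis i j ne))

-- Estimates for binomial coefficients

-- The identity (k + 1) C(n, k + 1) = (n - k) C(n, k), free of subtraction.
binom-absorb : ∀ n k → suc k * binom n (suc k) + k * binom n k ≡ n * binom n k
binom-absorb zero zero = refl
binom-absorb zero (suc k) = cong₂ _+_ (*-zeroʳ (suc (suc k))) (*-zeroʳ (suc k))
binom-absorb (suc n) zero = trans (add-one (binom n 1)) (cong suc (binom-absorb n zero))
  where
  add-one : ∀ x → 1 * (1 + x) + 0 ≡ suc (1 * x + 0)
  add-one x = solve (x ∙ ε)
binom-absorb (suc n) (suc k) = step (binom n k) (binom n (suc k)) (binom n (suc (suc k))) (binom-absorb n k) (binom-absorb n (suc k))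
  where
  step : ∀ x y z → suc k * y + k * x ≡ n * x → suc (suc k) * z + suc k * y ≡ n * y →
         suc (suc k) * (y + z) + suc k * (x + y) ≡ suc n * (x + y)
  step x y z e e′ = begin
    suc (suc k) * (y + z) + suc k * (x + y)                          ≡⟨ solve (x ∙ y ∙ z ∙ k ∙ ε) ⟩
    (suc (suc k) * z + suc k * y) + (suc k * y + k * x) + (x + y)    ≡⟨ cong₂ (λ a b → a + b + (x + y)) e′ e ⟩
    n * y + n * x + (x + y)                                          ≡⟨ solve (x ∙ y ∙ n ∙ ε) ⟩
    suc n * (x + y) ∎
    where open ≡-Reasoning

binom-growth : ∀ H w y → suc w * suc H + w ≤ y → suc H * binom y w ≤ binom y (suc w)
binom-growth H w y h = *-cancelˡ-≤ (suc w) (step (binom y w) (binom y (suc w)) (binom-absorb y w) (*-monoˡ-≤ (binom y w) h))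
  where
  step : ∀ b b′ → suc w * b′ + w * b ≡ y * b → (suc w * suc H + w) * b ≤ y * b → suc w * (suc H * b) ≤ suc w * b′
  step b b′ e h = ≤-by 0 (≤-trans h (≤-reflexive (sym e))) (solve (w ∙ H ∙ b ∙ b′ ∙ ε))

binom-mono : ∀ n k → binom n k ≤ binom (suc n) k
binom-mono n zero = ≤-refl
binom-mono n (suc k) = m≤n+m _ (binom n k)

ball-mono : ∀ n k → ball n k ≤ ball (suc n) k
ball-mono n zero = z≤n
ball-mono n (suc k) = +-mono-≤ (ball-mono n k) (binom-mono n k)

-- By Pascal's rule each of the `b` added points contributes one coefficient of lower order, which
-- is at most the ball.
binom-shift : ∀ b y w → binom (b + y) w ≤ binom y w + b * ball (b + y) w
binom-shift zero y w = m≤m+n _ _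
binom-shift (suc b) y zero = m≤m+n _ _
binom-shift (suc b) y (suc k) = step _ _ _ _ _ (binom-shift b y (suc k)) (m≤n+m (binom (b + y) k) (ball (b + y) k)) (ball-mono (b + y) (suc k))
  where
  step : ∀ p q r β β′ → q ≤ r + b * β → p ≤ β → β ≤ β′ → p + q ≤ r + suc b * β′
  step p q r β β′ h₁ h₂ h₃ = ≤-by 0 (+-mono-≤ (+-mono-≤ h₂ h₁) (scale (suc b) h₃)) (solve (p ∙ q ∙ r ∙ b ∙ β ∙ β′ ∙ ε))

-- Induction on `w`: `binom-shift` compares the new top term of the ball with C(y, w), which is
-- small against C(y, w + 1) by `binom-growth`. The factor `H * b + H` in the induction hypothesis
-- absorbs the error of the shift.
ball-negligible : ∀ w H b → ∃ λ y₀ → ∀ y → y₀ ≤ y → H * ball (b + y) w < binom y w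
ball-negligible zero H b = 0 , λ y _ → s≤s (≤-reflexive (*-zeroʳ H))
ball-negligible (suc w) H b with ball-negligible w (H * b + H) b
... | y₁ , ih = y₁ + (suc w * suc H + w) , λ y h →
      step _ _ _ _ (binom-shift b y w) (ih y (≤-trans (m≤m+n y₁ _) h)) (binom-growth H w y (≤-trans (m≤n+m _ y₁) h))
  where
  step : ∀ β p q r → p ≤ q + b * β → (H * b + H) * β < q → suc H * q ≤ r → H * (β + p) < r
  step β p q r h₁ h₂ h₃ = ≤-by 0 (+-mono-≤ (+-mono-≤ (scale H h₁) h₂) h₃) (solve (H ∙ b ∙ β ∙ p ∙ q ∙ r ∙ ε))

-- Each factor of the first falling product is at most `z` times the corresponding factor of the
-- second.
binom-ratio : ∀ z n₁ n₂ w → n₁ + z * w ≤ z * n₂ → binom n₁ w ≤ z ^ w * binom n₂ w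
binom-ratio z n₁ n₂ zero h = ≤-refl
binom-ratio z n₁ n₂ (suc w) h =
  *-cancelˡ-≤ (suc w) (step _ _ _ _ (z ^ w) (binom-absorb n₁ w) (binom-absorb n₂ w) (binom-ratio z n₁ n₂ w h′) )
  where
  h′ : n₁ + z * w ≤ z * n₂
  h′ = ≤-trans (+-monoʳ-≤ n₁ (scale z (n≤1+n w))) h
  step : ∀ b b′ d d′ Z → suc w * b′ + w * b ≡ n₁ * b → suc w * d′ + w * d ≡ n₂ * d → b ≤ Z * d → suc w * b′ ≤ suc w * (z * Z * d′)
  step b b′ d d′ Z e₁ e₂ h₁ =
    ≤-by (w * b) (+-mono-≤ (+-mono-≤ (≤-reflexive e₁) (scale n₁ h₁)) (+-mono-≤ (scale (Z * d) h′) (≤-reflexive (cong (Z * z *_) (sym e₂)))))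
      (solve (w ∙ z ∙ n₁ ∙ n₂ ∙ b ∙ b′ ∙ d ∙ d′ ∙ Z ∙ ε))

-- Families on boundedly many points

lo-mono : ∀ {n} {j k} (A : Subset n) → j ≤ k → lo j A ≤ lo k A
lo-mono A z≤n = z≤n
lo-mono [] (s≤s h) = z≤n
lo-mono (b ∷ A) (s≤s h) = +-monoʳ-≤ (bit b) (lo-mono A h)

-- gap (n − 3) n is {n−2, n} ⊆ [n], next to the top pair {n−1, n} in the shifting order.
gap : ℕ → ∀ n → Subset n
gap zero (suc (suc n)) = true ∷ false ∷ seg 0 1 n
gap (suc y) (suc n) = false ∷ gap y n
gap _ zero = []
gap zero (suc zero) = false ∷ []

#-gap : ∀ y n → 3 + y ≤ n → # (gap y n) ≡ 2
#-gap zero (suc (suc n)) (s≤s (s≤s h)) = cong suc (#-seg 0 1 n h)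
#-gap (suc y) (suc n) (s≤s h) = #-gap y n h

lo-gap : ∀ y n → lo y (gap y n) ≡ 0
lo-gap zero n = refl
lo-gap (suc y) zero = refl
lo-gap (suc y) (suc n) = lo-gap y n

lo-gap-2 : ∀ y n → 3 + y ≤ n → lo (2 + y) (gap y n) ≡ 1
lo-gap-2 zero (suc (suc n)) h = refl
lo-gap-2 zero (suc zero) (s≤s ())
lo-gap-2 (suc y) (suc n) (s≤s h) = lo-gap-2 y n h

gap≢seg : ∀ y z n → 3 + y ≤ n → gap y n ≢ seg z 2 n
gap≢seg zero zero (suc (suc n)) h ()
gap≢seg zero (suc z) (suc (suc n)) h ()
gap≢seg zero (suc z) (suc zero) (s≤s ())
gap≢seg (suc y) zero (suc n) h ()
gap≢seg (suc y) (suc z) (suc n) (s≤s h) e = gap≢seg y z n h (cong tail e)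

Dom-gap : ∀ y n → 3 + y ≤ n → Dom 0 (gap y n) (seg y 2 n) 0
Dom-gap zero (suc (suc (suc n))) h = same true (gain (lose (Dom-refl _)))
Dom-gap zero (suc (suc zero)) (s≤s (s≤s ()))
Dom-gap zero (suc zero) (s≤s ())
Dom-gap (suc y) (suc n) (s≤s h) = same false (Dom-gap y n h)

run : ℕ → ℕ → ℕ → ∀ n → List (Subset n)
run w y zero n = []
run w y (suc t) n = seg y w n ∷ run w (suc y) t n

length-run : ∀ w y t n → length (run w y t n) ≡ t
length-run w y zero n = refl
length-run w y (suc t) n = cong suc (length-run w (suc y) t n)

run-# : ∀ w y t n → y + t + w ≤ suc n → All (λ A → # A ≡ w) (run w y t n)
run-# w y zero n h = []
run-# w y (suc t) n h = #-seg y w n (≤-by t h (solve (w ∙ y ∙ t ∙ n ∙ ε))) ∷ run-# w (suc y) t n (subst (λ z → z + w ≤ suc n) (+-suc y t) h)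

run-lo : ∀ w j y t n → j ≤ y → All (λ A → lo j A ≡ 0) (run w y t n)
run-lo w j y zero n h = []
run-lo w j y (suc t) n h = n≤0⇒n≡0 (subst (lo j (seg y w n) ≤_) (lo-seg y w n) (lo-mono (seg y w n) h)) ∷ run-lo w j (suc y) t n (m≤n⇒m≤1+n h)

lo-suc-seg : ∀ y w n → y + suc w ≤ n → lo (suc y) (seg y (suc w) n) ≡ 1
lo-suc-seg zero w (suc n) h = refl
lo-suc-seg (suc y) w (suc n) (s≤s h) = lo-suc-seg y w n h

run-unique : ∀ w y t n → y + t + suc w ≤ suc n → Unique (run (suc w) y t n)
run-unique w y zero n h = []
run-unique w y (suc t) n h =
  All.map (λ {A} e e′ → 0≢1+n (trans (sym e) (trans (cong (lo (suc y)) (sym e′)) (lo-suc-seg y w n (≤-by t h (solve (w ∙ y ∙ t ∙ n ∙ ε)))))))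
          (run-lo (suc w) (suc y) (suc y) t n ≤-refl)
  ∷ run-unique w (suc y) t n (subst (λ z → z + suc w ≤ suc n) (+-suc y t) h)

gap-∉-run : ∀ y n → 3 + y ≤ n → ∀ z t → All (gap y n ≢_) (run 2 z t n)
gap-∉-run y n h z zero = []
gap-∉-run y n h z (suc t) = gap≢seg y z n h ∷ gap-∉-run y n h (suc z) t

AllBelow-0 : ∀ {n} w (G : Family n) → AllBelow (suc w) 0 G
AllBelow-0 w G A _ ()

module Small {n : ℕ} (G : Family n) (closed : DomClosed G) where

  _∉G : Subset n → Set
  A ∉G = ¬ T (G A)

  -- Each segment of the run shifts to its predecessor, so absence passes upwards.
  run-∉ : ∀ w y t → y + t + w ≤ suc n → seg y w n ∉G → All _∉G (run w y t n)
  run-∉ w y zero h h′ = []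
  run-∉ w y (suc zero) h h′ = h′ ∷ []
  run-∉ w y (suc (suc t)) h h′ = h′ ∷ run-∉ w (suc y) (suc t) h₁ (h′ ∘ closed (Dom-seg-below 0 y w _
      (#-seg (suc y) w n (≤-by t h (solve (w ∙ y ∙ t ∙ n ∙ ε))))
      (n≤0⇒n≡0 (subst (lo y (seg (suc y) w n) ≤_) (lo-seg (suc y) w n) (lo-mono (seg (suc y) w n) (n≤1+n y))))))
    where
    h₁ : suc y + suc t + w ≤ suc n
    h₁ = ≤-by 0 h (solve (w ∙ y ∙ t ∙ n ∙ ε))

  -- All `r` singletons from position `q` on are absent. The list `As` has no singletons, so nothing
  -- is counted twice.
  absent-singles : ∀ q r {As} → q + r ≡ n → seg q 1 n ∉G → Unique As → All _∉G As → All (λ A → # A ≢ 1) As → r + length As ≤ count (not ∘ G)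
  absent-singles q r {As} e h u h′ ne = subst (_≤ count (not ∘ G)) (trans (length-++ (run 1 q r n)) (cong (_+ length As) (length-run 1 q r n)))
    (length≤count G (Unique.++⁺ (run-unique 0 q r n b) u λ { (x , y) → All.lookup ne y (All.lookup (run-# 1 q r n b) x) }) (AllP.++⁺ (run-∉ 1 q r b h) h′))
    where
    b : q + r + 1 ≤ suc n
    b = ≤-reflexive (trans (+-comm (q + r) 1) (cong suc e))

  -- n − c disjoint members of G, of which only S may be empty.
  Outcome : ℕ → Set
  Outcome c = ∃ λ g → ∃ λ S → ∃ λ V → suc g + c ≡ n × Split full S V × T (G S) × Matching G g V

  from-∅ : ∀ {g} c → suc g + c ≡ n → T (G ⊥) → Matching G g full → Outcome c
  from-∅ c e h M = _ , ⊥ , full , e , Split-none full , h , M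

  from-matching : ∀ {g} c → suc g + c ≡ n → Matching G (suc g) full → Outcome c
  from-matching c e (add p _ h M) = _ , _ , _ , e , p , h , M

  full-pairs : ∀ q z a p → AllBelow 1 q G → AllBelow 2 z G → a ≤ q → q ≤ n → a + p * 2 ≤ z → z ≤ n → Matching G (a + p) full
  full-pairs q z a p ab₁ ab₂ h₁ h₂ h₃ h₄ =
    singles-pairs q z ab₁ ab₂ a p full (subst (a ≤_) (sym (lo-full q h₂)) h₁) (subst (a + p * 2 ≤_) (sym (lo-full z h₄)) h₃)

  below : ∀ y w → y + w ≤ n → T (G (seg y w n)) → AllBelow w (y + w) G
  below y w h p = seg⇒AllBelow {G = G} y w closed h p

  single-below : ∀ y → suc y ≤ n → T (G (seg y 1 n)) → AllBelow 1 (suc y) G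
  single-below y h p = subst (λ z → AllBelow 1 z G) (+-comm y 1) (below y 1 (subst (_≤ n) (+-comm 1 y) h) p)

  -- Searches for the place where presence of singletons ends. The sum `d + e` is kept because it
  -- will be `c`.
  switch : ∀ k e d → T (G (seg (k + d) 1 n)) → seg (suc (k + d) + e) 1 n ∉G →
           ∃ λ d′ → ∃ λ e′ → d + e ≡ d′ + e′ × T (G (seg (k + d′) 1 n)) × seg (suc (k + d′)) 1 n ∉G
  switch k zero d h h′ = d , 0 , refl , h , subst (λ z → seg z 1 n ∉G) (+-identityʳ _) h′
  switch k (suc e) d h h′ with T? (G (seg (suc (k + d)) 1 n))
  ... | no h₁ = d , suc e , refl , h , h₁
  ... | yes h₁ with switch k e (suc d) (subst (λ z → T (G (seg z 1 n))) (sym (+-suc k d)) h₁)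
                      (subst (λ z → seg z 1 n ∉G) (move k d e) h′)
    where
    move : ∀ k d e → suc (k + d) + suc e ≡ suc (k + suc d) + e
    move k d e = solve (k ∙ d ∙ e ∙ ε)
  ... | d′ , e′ , eq , r = d′ , e′ , trans (+-suc d e) eq , r

  #≢1 : ∀ (A : Subset n) {w} → w ≢ 1 → # A ≡ w → # A ≢ 1
  #≢1 A ne e e′ = ne (trans (sym e) e′)

  ⊥≢ : ∀ {A : Subset n} {w} → w ≢ 0 → # A ≡ w → ⊥ ≢ A
  ⊥≢ ne e refl = ne (trans (sym e) (#⊥ {n}))

  ⊥-#≢1 : # {n} ⊥ ≢ 1
  ⊥-#≢1 = #≢1 ⊥ (λ ()) (#⊥ {n})

  singles-below : ∀ k c → suc k + suc (c + c) ≡ n → AllBelow 1 k G ⊎ 3 + (c + c) ≤ count (not ∘ G)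
  singles-below zero c e = inj₁ (AllBelow-0 0 G)
  singles-below (suc j) c e with T? (G (seg j 1 n))
  ... | no h = inj₂ (≤-trans (≤-reflexive (sym (+-identityʳ _))) (absent-singles j (3 + (c + c)) (trans (move j c) e) h [] [] []))
    where
    move : ∀ j c → j + (3 + (c + c)) ≡ suc (suc j) + suc (c + c)
    move j c = solve (j ∙ c ∙ ε)
  ... | yes h = inj₁ (single-below j (≤-by (2 + (c + c)) (≤-reflexive e) (solve (j ∙ c ∙ n ∙ ε))) h)

  -- Here `2 * c + 2` singletons are absent, so one more absence suffices. Otherwise the empty set,
  -- the first `k` singletons and `c + 1` pairs of later points are `n − c` disjoint members.
  no-singles : ∀ k c → suc k + suc (c + c) ≡ n → seg k 1 n ∉G → Outcome c ⊎ 3 + (c + c) ≤ count (not ∘ G)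
  no-singles k c e h with T? (G ⊥) | T? (G (seg (k + (c + c)) 2 n)) | singles-below k c e
  ... | _ | _ | inj₂ big = inj₂ big
  ... | no h∅ | _ | _ = inj₂ (≤-trans (≤-reflexive (+-comm 1 (2 + (c + c)))) (absent-singles k (2 + (c + c)) (trans (+-suc k _) e) h ([] ∷ []) (h∅ ∷ []) (⊥-#≢1 ∷ [])))
  ... | yes _ | no hp | _ = inj₂ (≤-trans (≤-reflexive (+-comm 1 (2 + (c + c)))) (absent-singles k (2 + (c + c)) (trans (+-suc k _) e) h ([] ∷ []) (hp ∷ [])
          (#≢1 (seg (k + (c + c)) 2 n) (λ ()) (#-seg (k + (c + c)) 2 n (≤-by 0 (≤-reflexive e) (solve (k ∙ c ∙ n ∙ ε)))) ∷ [])))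
  ... | yes h∅ | yes hp | inj₁ ab = inj₁ (from-∅ c (trans (total k c) e) h∅
          (full-pairs k _ k (suc c) ab (below _ 2 z≤ hp) ≤-refl (≤-by (2 + (c + c)) (≤-reflexive e) (solve (k ∙ c ∙ n ∙ ε))) (≤-reflexive (pairs k c)) z≤))
    where
    z≤ : k + (c + c) + 2 ≤ n
    z≤ = ≤-by 0 (≤-reflexive e) (solve (k ∙ c ∙ n ∙ ε))
    total : ∀ k c → suc (k + suc c) + c ≡ suc k + suc (c + c)
    total k c = solve (k ∙ c ∙ ε)
    pairs : ∀ k c → k + suc c * 2 ≡ k + (c + c) + 2
    pairs k c = solve (k ∙ c ∙ ε)

  module _ (y : ℕ) (y+3≡n : 3 + y ≡ n) (no-top : seg (suc y) 2 n ∉G) where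

    private
      y+3≤n = ≤-reflexive y+3≡n

    gap-#≢1 : # (gap y n) ≢ 1
    gap-#≢1 = #≢1 (gap y n) (λ ()) (#-gap y n y+3≤n)

    ⊥≢gap : ⊥ ≢ gap y n
    ⊥≢gap = ⊥≢ {gap y n} (λ ()) (#-gap y n y+3≤n)

    gap⇒pairs : T (G (gap y n)) → AllBelow 2 (2 + y) G
    gap⇒pairs h = subst (λ z → AllBelow 2 z G) (+-comm y 2)
      (below y 2 (≤-trans (≤-reflexive (+-comm y 2)) (≤-trans (n≤1+n _) y+3≤n)) (closed (Dom-gap y n y+3≤n) h))

    run-#≢1 : ∀ z t → z + t + 2 ≤ suc n → All (λ A → # A ≢ 1) (run 2 z t n)
    run-#≢1 z t h = All.map (λ {A} → #≢1 A (λ ())) (run-# 2 z t n h)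

    absent-pairs : ∀ q r z t → q + r ≡ n → seg q 1 n ∉G → gap y n ∉G → seg z 2 n ∉G → z + t + 2 ≤ suc n → r + suc t ≤ count (not ∘ G)
    absent-pairs q r z t e h hg hz b = ≤-trans (≤-reflexive (cong (λ x → r + suc x) (sym (length-run 2 z t n))))
      (absent-singles q r e h (gap-∉-run y n y+3≤n z t ∷ run-unique 1 z t n b) (hg ∷ run-∉ 2 z t b hz) (gap-#≢1 ∷ run-#≢1 z t b))

    absent-pairs-∅ : ∀ q r z t → q + r ≡ n → seg q 1 n ∉G → ⊥ ∉G → gap y n ∉G → seg z 2 n ∉G → z + t + 2 ≤ suc n → r + suc (suc t) ≤ count (not ∘ G)
    absent-pairs-∅ q r z t e h h∅ hg hz b = ≤-trans (≤-reflexive (cong (λ x → r + suc (suc x)) (sym (length-run 2 z t n))))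
      (absent-singles q r e h ((⊥≢gap ∷ All.map (λ {A} → ⊥≢ {A} (λ ())) (run-# 2 z t n b)) ∷ (gap-∉-run y n y+3≤n z t ∷ run-unique 1 z t n b))
        (h∅ ∷ hg ∷ run-∉ 2 z t b hz) (⊥-#≢1 ∷ gap-#≢1 ∷ run-#≢1 z t b))

    -- Here `2 * c + 1` singletons and the top pair are absent, so one more absence suffices.
    -- Otherwise the empty set, `q` singletons and `c` pairs fill the first `n − 1` points.
    few-singles : ∀ q c → q + suc (c + c) ≡ n → AllBelow 1 q G → seg q 1 n ∉G → Outcome c ⊎ 3 + (c + c) ≤ count (not ∘ G)
    few-singles q c e ab h with T? (G (gap y n)) | T? (G ⊥)
    ... | no hg | _ = inj₂ (≤-trans (≤-reflexive (+-comm 2 (suc (c + c)))) (absent-pairs q (suc (c + c)) (suc y) 1 e h hg no-top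
            (≤-by 0 (≤-reflexive y+3≡n) (solve (y ∙ n ∙ ε)))))
    ... | yes hg | no h∅ = inj₂ (≤-trans (≤-reflexive (+-comm 2 (suc (c + c)))) (absent-singles q (suc (c + c)) e h
            ((⊥≢ {seg (suc y) 2 n} (λ ()) #top ∷ []) ∷ [] ∷ []) (h∅ ∷ no-top ∷ []) (⊥-#≢1 ∷ #≢1 (seg (suc y) 2 n) (λ ()) #top ∷ [])))
      where
      #top : # (seg (suc y) 2 n) ≡ 2
      #top = #-seg (suc y) 2 n (≤-by 0 (≤-reflexive y+3≡n) (solve (y ∙ n ∙ ε)))
    ... | yes hg | yes h∅ = inj₁ (from-∅ c (trans (total q c) e) h∅
            (full-pairs q (2 + y) q c ab (gap⇒pairs hg) ≤-refl (≤-by (suc (c + c)) (≤-reflexive e) (solve (q ∙ c ∙ n ∙ ε)))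
              (≤-by 0 (≤-reflexive (trans e (sym y+3≡n))) (solve (q ∙ c ∙ y ∙ ε))) (≤-by 1 y+3≤n (solve (y ∙ n ∙ ε)))))
      where
      total : ∀ q c → suc (q + c) + c ≡ q + suc (c + c)
      total q c = solve (q ∙ c ∙ ε)

    -- With `c = d + e + 1`, an outcome needs `q + e + 1` sets. They are `q` singletons and pairs,
    -- with the gap pair or the empty set where available; if a pair needed for this is absent, so
    -- are the pairs after it.
    more-singles : ∀ q d e → q + (2 + d + (e + e)) ≡ n → 1 ≤ d + e → AllBelow 1 q G → seg q 1 n ∉G →
                   Outcome (suc (d + e)) ⊎ 3 + (suc (d + e) + suc (d + e)) ≤ count (not ∘ G)
    more-singles q d e eq d+e≥1 ab h = cases (T? (G (gap y n))) (T? (G ⊥))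
      where
      total : ∀ q d e → suc (q + e) + suc (d + e) ≡ q + (2 + d + (e + e))
      total q d e = solve (q ∙ d ∙ e ∙ ε)
      q≤y : q ≤ y
      q≤y = ≤-by e (+-mono-≤ d+e≥1 (≤-reflexive (trans eq (sym y+3≡n)))) (solve (q ∙ d ∙ e ∙ y ∙ ε))
      q≤n : q ≤ n
      q≤n = subst (q ≤_) eq (m≤m+n q _)
      -- The gap pair takes only one of the first `n − 1` points, so `q` singletons and `e` pairs
      -- still fit there.
      with-gap : T (G (gap y n)) → Outcome (suc (d + e))
      with-gap hg with complement-Split (gap y n)
      ... | V , s = q + e , gap y n , V , trans (total q d e) eq , s , hg , singles-pairs q (2 + y) ab (gap⇒pairs hg) q e V
              (≤-reflexive (trans (sym (lo-full q q≤n)) (trans (lo-Split q s) (cong (_+ lo q V) lo-q))))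
              (room (lo (2 + y) V) (trans (sym (lo-full (2 + y) (≤-trans (n≤1+n _) y+3≤n))) (trans (lo-Split (2 + y) s) (cong (_+ lo (2 + y) V) (lo-gap-2 y n y+3≤n)))))
        where
        lo-q : lo q (gap y n) ≡ 0
        lo-q = n≤0⇒n≡0 (subst (lo q (gap y n) ≤_) (lo-gap y n) (lo-mono (gap y n) q≤y))
        room : ∀ x → 2 + y ≡ 1 + x → q + e * 2 ≤ x
        room x h′ = ≤-by d (+-mono-≤ (≤-reflexive (trans eq (sym y+3≡n))) (≤-reflexive h′)) (solve (q ∙ d ∙ e ∙ y ∙ x ∙ ε))
      without-∅ : gap y n ∉G → ⊥ ∉G → Outcome (suc (d + e)) ⊎ 3 + (suc (d + e) + suc (d + e)) ≤ count (not ∘ G)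
      without-∅ hg h∅ with T? (G (seg (q + (e + e)) 2 n))
      ... | yes hp = inj₁ (from-matching {q + e} (suc (d + e)) (trans (total q d e) eq) (subst (λ z → Matching G z full) (+-suc q e)
              (full-pairs q (q + (e + e) + 2) q (suc e) ab (below _ 2 z≤ hp) ≤-refl q≤n (≤-reflexive (solve (q ∙ e ∙ ε))) z≤)))
        where
        z≤ : q + (e + e) + 2 ≤ n
        z≤ = ≤-by d (≤-reflexive eq) (solve (q ∙ d ∙ e ∙ n ∙ ε))
      -- The empty set, the gap pair and `d + 1` segments add exactly the `d + 3` absences still
      -- required.
      ... | no hp = inj₂ (≤-trans (≤-reflexive (total-absent d e)) (absent-pairs-∅ q (2 + d + (e + e)) (q + (e + e)) (suc d) eq h h∅ hg hp
              (≤-by 0 (≤-reflexive eq) (solve (q ∙ d ∙ e ∙ n ∙ ε)))))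
        where
        total-absent : ∀ d e → 3 + (suc (d + e) + suc (d + e)) ≡ 2 + d + (e + e) + suc (suc (suc d))
        total-absent d e = solve (d ∙ e ∙ ε)
      with-∅ : ∀ e′ → e ≡ e′ → gap y n ∉G → T (G ⊥) → Outcome (suc (d + e)) ⊎ 3 + (suc (d + e) + suc (d + e)) ≤ count (not ∘ G)
      with-∅ zero refl hg h∅ = inj₁ (from-∅ {q + 0} (suc (d + 0)) (trans (total q d 0) eq) h∅
        (subst (λ z → Matching G z full) (sym (+-identityʳ q)) (singles q ab q full (≤-reflexive (sym (lo-full q q≤n))))))
      with-∅ (suc e′) refl hg h∅ with T? (G (seg (q + (e′ + e′)) 2 n))
      ... | yes hp = inj₁ (from-∅ {q + suc e′} (suc (d + e)) (trans (total q d e) eq) h∅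
              (full-pairs q (q + (e′ + e′) + 2) q (suc e′) ab (below _ 2 z≤ hp) ≤-refl q≤n (≤-reflexive (solve (q ∙ e′ ∙ ε))) z≤))
        where
        z≤ : q + (e′ + e′) + 2 ≤ n
        z≤ = ≤-by (2 + d) (≤-reflexive eq) (solve (q ∙ d ∙ e′ ∙ n ∙ ε))
      -- The first pair looked at lies two positions lower than in `without-∅`, so two more pairs
      -- are absent; this outweighs the presence of the empty set.
      ... | no hp = inj₂ (weaken _ (absent-pairs q (2 + d + (e + e)) (q + (e′ + e′)) (3 + d) eq h hg hp
              (≤-by 0 (≤-reflexive eq) (solve (q ∙ d ∙ e′ ∙ n ∙ ε)))))
        where
        weaken : ∀ x → 2 + d + (suc e′ + suc e′) + suc (3 + d) ≤ x → 3 + (suc (d + suc e′) + suc (d + suc e′)) ≤ x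
        weaken x h′ = ≤-by 1 h′ (solve (d ∙ e′ ∙ x ∙ ε))
      cases : Dec (T (G (gap y n))) → Dec (T (G ⊥)) → Outcome (suc (d + e)) ⊎ 3 + (suc (d + e) + suc (d + e)) ≤ count (not ∘ G)
      cases (yes hg) _ = inj₁ (with-gap hg)
      cases (no hg) (no h∅) = without-∅ hg h∅
      cases (no hg) (yes h∅) = with-∅ e refl hg h∅

  -- The second and third alternatives are the shapes of the links of Q and W.
  Alternatives : ℕ → ℕ → Set
  Alternatives k c = Outcome c ⊎ (AllBelow 1 (suc k) G × AllBelow 2 n G) ⊎ (c ≡ 1 × AllBelow 1 (2 + k) G) ⊎ 3 + (c + c) ≤ count (not ∘ G)

  outer : ∀ {k c} → Outcome c ⊎ 3 + (c + c) ≤ count (not ∘ G) → Alternatives k c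
  outer (inj₁ a) = inj₁ a
  outer (inj₂ d) = inj₂ (inj₂ (inj₂ d))

  -- Exactly the first `k + d + 1` singletons are present. The case `d = 0` is `few-singles`,
  -- `d = 1` with `e = 0` is the shape belonging to `W`, and the rest is `more-singles` with `d`
  -- lowered by one.
  small-no-top : ∀ k c₁ d e → suc c₁ ≡ d + e → suc k + suc (suc c₁ + suc c₁) ≡ n → seg (k + (suc c₁ + suc c₁)) 2 n ∉G →
                 T (G (seg (k + d) 1 n)) → seg (suc (k + d)) 1 n ∉G → Alternatives k (suc c₁)
  small-no-top k c₁ d e c≡ eq htop h₁ h₂ = cases d e c≡ h₁ h₂
    where
    y = k + (c₁ + suc c₁)
    y+3≡n : 3 + y ≡ n
    y+3≡n = trans (total k c₁) eq
      where
      total : ∀ k c → 3 + (k + (c + suc c)) ≡ suc k + suc (suc c + suc c)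
      total k c = solve (k ∙ c ∙ ε)
    no-top : seg (suc y) 2 n ∉G
    no-top = subst (λ z → seg z 2 n ∉G) (+-suc k _) htop
    more : ∀ d e → 1 ≤ d + e → c₁ ≡ d + e → T (G (seg (k + suc d) 1 n)) → seg (suc (k + suc d)) 1 n ∉G → Alternatives k (suc c₁)
    more d e d+e≥1 refl h₁ h₂ = outer (more-singles y y+3≡n no-top (suc (k + suc d)) d e (trans (total k d e) eq) d+e≥1
        (single-below (k + suc d) (≤-by (2 + d + (e + e)) (≤-reflexive eq) (solve (k ∙ d ∙ e ∙ n ∙ ε))) h₁) h₂)
      where
      total : ∀ k d e → suc (k + suc d) + (2 + d + (e + e)) ≡ suc k + suc (suc (d + e) + suc (d + e))
      total k d e = solve (k ∙ d ∙ e ∙ ε)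
    cases : ∀ d e → suc c₁ ≡ d + e → T (G (seg (k + d) 1 n)) → seg (suc (k + d)) 1 n ∉G → Alternatives k (suc c₁)
    cases zero e c≡ h₁ h₂ = outer (few-singles y y+3≡n no-top (suc k) (suc c₁) eq
      (subst (λ z → AllBelow 1 (suc z) G) (+-identityʳ k) (single-below (k + 0) (≤-by (3 + (c₁ + c₁)) (≤-reflexive eq) (solve (k ∙ c₁ ∙ n ∙ ε))) h₁))
      (subst (λ z → seg (suc z) 1 n ∉G) (+-identityʳ k) h₂))
    cases (suc zero) zero refl h₁ h₂ =
      inj₂ (inj₂ (inj₁ (refl , subst (λ z → AllBelow 1 (suc z) G) (+-comm k 1) (single-below (k + 1) (≤-by 2 (≤-reflexive eq) (solve (k ∙ n ∙ ε))) h₁))))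
    cases (suc zero) (suc e) c≡ h₁ h₂ = more 0 (suc e) (s≤s z≤n) (suc-injective c≡) h₁ h₂
    cases (suc (suc d)) e c≡ h₁ h₂ = more (suc d) e (s≤s z≤n) (suc-injective c≡) h₁ h₂

  small : ∀ k c → 1 ≤ c → suc k + suc (c + c) ≡ n → Alternatives k c
  small k (suc c₁) _ eq with T? (G (seg k 1 n))
  ... | no h = outer (no-singles k (suc c₁) eq h)
  ... | yes h with T? (G (seg (k + (suc c₁ + suc c₁)) 2 n))
  ... | yes htop = inj₂ (inj₁ (single-below k (≤-by (3 + (c₁ + c₁)) (≤-reflexive eq) (solve (k ∙ c₁ ∙ n ∙ ε))) h ,
                               subst (λ z → AllBelow 2 z G) (trans (total k (suc c₁)) eq) (below (k + (suc c₁ + suc c₁)) 2 (≤-reflexive (trans (total k (suc c₁)) eq)) htop)))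
    where
    total : ∀ k c → k + (c + c) + 2 ≡ suc k + suc (c + c)
    total k c = solve (k ∙ c ∙ ε)
  ... | no htop with T? (G (seg (suc k + suc c₁) 1 n))
  -- The first `k + c + 2` singletons are already `n − c` disjoint members.
  ... | yes hc = inj₁ (from-matching {suc k + suc c₁} (suc c₁) (trans (total k (suc c₁)) eq)
                   (singles q (single-below (suc k + suc c₁) q≤ hc) q full (≤-reflexive (sym (lo-full q q≤)))))
    where
    q = suc (suc k + suc c₁)
    total : ∀ k c → suc (suc k + c) + c ≡ suc k + suc (c + c)
    total k c = solve (k ∙ c ∙ ε)
    q≤ : q ≤ n
    q≤ = ≤-trans (m≤m+n q (suc c₁)) (≤-reflexive (trans (total k (suc c₁)) eq))
  ... | no hc with switch k (suc c₁) 0 (subst (λ z → T (G (seg z 1 n))) (sym (+-identityʳ k)) h) (subst (λ z → seg (suc z + suc c₁) 1 n ∉G) (sym (+-identityʳ k)) hc)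
  ... | d , e , c≡ , h₁ , h₂ = small-no-top k c₁ d e c≡ eq htop h₁ h₂

-- The structure of large families without s disjoint members

halve-odd : ∀ x y → 2 * x ≤ 2 * y + 1 → x ≤ y
halve-odd x y h = ≮⇒≥ λ y<x → <-irrefl refl (contra (≤-trans (scale 2 y<x) h))
  where
  contra : 2 * suc y ≤ 2 * y + 1 → 2 * y + 1 < 2 * y + 1
  contra h = ≤-by 0 h (solve (y ∙ ε))

seg-0-1 : ∀ n → seg 0 1 (suc n) ≡ true ∷ ⊥
seg-0-1 n = cong (true ∷_) (empty n)
  where
  empty : ∀ n → seg 0 0 n ≡ ⊥
  empty zero = refl
  empty (suc n) = cong (false ∷_) (empty n)

⌊half⌋-bounds : ∀ h → ∃ λ p → p * 2 ≤ h × h ≤ 1 + p * 2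
⌊half⌋-bounds zero = 0 , z≤n , z≤n
⌊half⌋-bounds (suc zero) = 0 , z≤n , s≤s z≤n
⌊half⌋-bounds (suc (suc h)) with ⌊half⌋-bounds h
... | p , l , u = suc p , s≤s (s≤s l) , s≤s (s≤s u)

module Core (w c k s N : ℕ) (c≥1 : 1 ≤ c) where

  K X D N₀ light : ℕ
  K = suc k + suc (c + c)
  -- Room for `w` points of each of up to `K` link members and for up to `w` points of `P`.
  X = suc K * w
  D = w * s
  -- When `N + K` is `m * s + c`, this is the cutoff `m * s ∸ c ∸ 1` of `Q`.
  N₀ = N + suc k
  -- The bound of `count-light` for the number of sets outside `Q`.
  light = binom N₀ w * suc (suc (c + c)) + ball N₀ w * sumOver {suc (c + c)} (λ _ → 1)

  module _ (N+K : N + K ≡ suc w * s + c) (K<s : K < s) (D+w≤N : D + w ≤ N) (X+w≤N : X + w ≤ N)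
           (light<₁ : light < binom (N ∸ X) w * (3 + (c + c))) (light<₂ : light < binom (N ∸ D) w * K)
           (F : Family (N + K)) (closed : DomClosed F) (ν : νLt F s) where

    module _ (strong : T (F (seg D w N ++ (true ∷ ⊥)))) where

      open Greedy {N} {k + suc (c + c)} w X D F closed D+w≤N X+w≤N strong using (link; extend)

      -- With `q = s − g − 1` filling sets, `P` and the `g` lifted link members would form a
      -- matching of size `s`. The last hypothesis says that the prefix has enough points for it.
      extension : ∀ {g} (PL : Subset N) {PH V} → T (F (PL ++ PH)) → Split full PH V → Matching link g V →
                  # PL ≤ w → g ≤ K → # PL + K ≤ g + suc w + c → ⊥₀
      extension {g} PL FP p M t≤w g≤K room with m≤n⇒∃[o]m+o≡n (≤-trans (s≤s g≤K) K<s)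
      ... | q , e = ν (subst (HasMatching F) e (extend q PL FP p M (+-mono-≤ t≤w (*-monoˡ-≤ w g≤K))
            (≤-trans (+-monoˡ-≤ _ t≤w) (≤-reflexive (trans (*-comm (suc (g + q)) w) (cong (w *_) e)))) (fits _ room (trans N+K (cong (λ z → suc w * z + c) (sym e))))))
        where
        fits : ∀ t → t + K ≤ g + suc w + c → N + K ≡ suc w * suc (g + q) + c → t + (g * w + q * suc w) ≤ N
        fits t h eq = arith K h eq
          where
          arith : ∀ K → t + K ≤ g + suc w + c → N + K ≡ suc w * suc (g + q) + c → t + (g * w + q * suc w) ≤ N
          arith K h eq = ≤-by 0 (+-mono-≤ h (≤-reflexive (sym eq))) (solve (t ∙ K ∙ g ∙ w ∙ c ∙ N ∙ q ∙ ε))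

      -- For `P` outside `Q`, the last `K` points missed by `P` are used as singletons among the
      -- first `k + 1` and as pairs among the others, and `extension` applies.
      Q-type : AllBelow 1 (suc k) link → AllBelow 2 K link → ∀ P → T (F P) → 2 * suc w ≤ # P + lo N₀ P
      Q-type ab₁ ab₂ P FP with splitAt N P
      ... | PL , PH , refl with complement-Split PH
      ... | V , sp with ⌊half⌋-bounds (hi (suc k) V)
      ... | p , p≤ , ≤p with 2 * suc w ≤? # (PL ++ PH) + lo N₀ (PL ++ PH)
      ... | yes h = h
      ... | no h = ⊥-elim (extension {lo (suc k) V + p} PL FP sp
            (singles-pairs (suc k) K ab₁ ab₂ (lo (suc k) V) p V ≤-refl fits)
            (t≤w (# PL) (lo (suc k) PH) (hi (suc k) PH) light′)
            (≤-trans (+-monoʳ-≤ (lo (suc k) V) (m≤m*n p 2)) (≤-trans fits (lo≤ K V)))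
            (room (# PL) (lo (suc k) PH) (hi (suc k) PH) (lo (suc k) V) (hi (suc k) V) light′
              (trans (sym (lo-Split (suc k) sp)) (lo-full {K} (suc k) (m≤m+n (suc k) _)))
              (+-cancelˡ-≡ (suc k) _ _ (trans (cong (_+ (hi (suc k) PH + hi (suc k) V)) (trans (sym (lo-full {K} (suc k) (m≤m+n (suc k) _))) (lo-Split (suc k) sp)))
                 (trans (interchange (lo (suc k) PH) (lo (suc k) V) (hi (suc k) PH) (hi (suc k) V)) (trans (cong₂ _+_ (lo+hi (suc k) PH) (lo+hi (suc k) V))
                   (trans (sym (#-Split sp)) (trans (sym (#≡lo {K} full)) (lo-full {K} K ≤-refl))))))) ≤p))
        where
        fits : lo (suc k) V + p * 2 ≤ lo K V
        fits = ≤-trans (+-monoʳ-≤ (lo (suc k) V) p≤) (≤-reflexive (trans (lo+hi (suc k) V) (sym (#≡lo V))))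
        light′ : (# PL + (lo (suc k) PH + hi (suc k) PH)) + (# PL + lo (suc k) PH) < 2 * suc w
        light′ = subst (_< 2 * suc w) (cong₂ _+_ (trans (#-++ PL PH) (cong (# PL +_) (sym (lo+hi (suc k) PH)))) (lo-++ PL PH (suc k))) (≰⇒> h)
        t≤w : ∀ t₁ t₂ j → (t₁ + (t₂ + j)) + (t₁ + t₂) < 2 * suc w → t₁ ≤ w
        t≤w t₁ t₂ j h = halve-odd t₁ w (≤-by (t₂ + t₂ + j) h (solve (t₁ ∙ t₂ ∙ j ∙ w ∙ ε)))
        room : ∀ t₁ t₂ j a h → (t₁ + (t₂ + j)) + (t₁ + t₂) < 2 * suc w → t₂ + a ≡ suc k → j + h ≡ suc (c + c) → h ≤ 1 + p * 2 →
               t₁ + (suc k + suc (c + c)) ≤ a + p + suc w + c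
        room t₁ t₂ j a h h₁ h₂ h₃ h₄ = ≤-by 0 (+-mono-≤ half (≤-reflexive (sym h₂))) (solve (t₁ ∙ t₂ ∙ a ∙ k ∙ p ∙ w ∙ c ∙ ε))
          where
          -- Pairing may waste one point; `halve-odd` makes up for it.
          half : t₁ + t₂ + c ≤ w + p
          half = halve-odd _ _ (≤-by 0 (+-mono-≤ (+-mono-≤ h₁ (≤-reflexive (sym h₃))) h₄) (solve (t₁ ∙ t₂ ∙ j ∙ h ∙ p ∙ w ∙ c ∙ ε)))

      -- As in `Q-type`, but the singletons that avoid `P` among the first `k + 2` of the last
      -- points are just enough by themselves.
      W-type : c ≡ 1 → AllBelow 1 (2 + k) link → ∀ P → T (F P) → suc w ≤ lo (N + (2 + k)) P
      W-type refl ab P FP with splitAt N P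
      ... | PL , PH , refl with complement-Split PH
      ... | V , sp with suc w ≤? lo (N + (2 + k)) (PL ++ PH)
      ... | yes h = h
      ... | no h = ⊥-elim (extension PL FP sp (singles (2 + k) ab (lo (2 + k) V) V ≤-refl)
            (≤-trans (m≤m+n (# PL) _) light′) (≤-trans (lo≤# (2 + k) V) (≤-trans (≤-reflexive (sym (#≡lo V))) (lo≤ K V)))
            (room (# PL) _ _ light′ (trans (sym (lo-Split (2 + k) sp)) (lo-full {K} (2 + k) 2+k≤K))))
        where
        2+k≤K : 2 + k ≤ K
        2+k≤K = ≤-trans (m≤m+n (2 + k) 2) (≤-reflexive (total k))
          where
          total : ∀ k → 2 + k + 2 ≡ suc k + 3
          total k = solve (k ∙ ε)
        light′ : # PL + lo (2 + k) PH ≤ w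
        light′ = s≤s⁻¹ (subst (_< suc w) (lo-++ PL PH (2 + k)) (≰⇒> h))
        room : ∀ t₁ t₂ a → t₁ + t₂ ≤ w → t₂ + a ≡ 2 + k → t₁ + (suc k + 3) ≤ a + suc w + 1
        room t₁ t₂ a h₁ h₂ = ≤-by 0 (+-mono-≤ h₁ (≤-reflexive (sym h₂))) (solve (t₁ ∙ t₂ ∙ a ∙ k ∙ w ∙ ε))

    core : light < count (not ∘ F) ⊎ (∀ P → T (F P) → 2 * suc w ≤ # P + lo N₀ P) ⊎ (c ≡ 1 × (∀ P → T (F P) → suc w ≤ lo (N + (2 + k)) P))
    core with T? (F (seg D w N ++ (true ∷ ⊥)))
    -- All `K` singletons are then absent from the link at `D`, which costs more than `light`.
    ... | no h = inj₁ (<-≤-trans light<₂ (≤-trans (scale (binom (N ∸ D) w) absent) (count-link D w F closed)))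
      where
      absent : K ≤ count (λ S → not (F (seg D w N ++ S)))
      absent = ≤-trans (≤-reflexive (sym (+-identityʳ K)))
        (Small.absent-singles (λ S → F (seg D w N ++ S)) (DomClosed-++ {F = F} (seg D w N) closed) 0 K refl
          (subst (λ z → ¬ T (F (seg D w N ++ z))) (sym (seg-0-1 (k + suc (c + c)))) h) [] [] [])
    ... | yes strong with Small.small (λ S → F (seg X w N ++ S)) (DomClosed-++ {F = F} (seg X w N) closed) k c c≥1 refl
    -- The member `S` that may be empty, completed by `seg X w N`, plays the role of `P`.
    ... | inj₁ (g , S , V , e , sp , h , M) = ⊥-elim (extension strong (seg X w N) h sp M (≤-reflexive #s) (≤-trans (m≤m+n g c) (≤-trans (n≤1+n _) (≤-reflexive e)))
            (≤-reflexive (trans (cong₂ _+_ #s (sym e)) (total w g c))))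
      where
      #s = #-seg X w N X+w≤N
      total : ∀ w g c → w + (suc g + c) ≡ g + suc w + c
      total w g c = solve (w ∙ g ∙ c ∙ ε)
    ... | inj₂ (inj₁ (ab₁ , ab₂)) = inj₂ (inj₁ (Q-type strong ab₁ ab₂))
    ... | inj₂ (inj₂ (inj₁ (e , ab))) = inj₂ (inj₂ (e , W-type strong e ab))
    ... | inj₂ (inj₂ (inj₂ big)) = inj₁ (<-≤-trans light<₁ (≤-trans (scale (binom (N ∸ X) w) big) (count-link X w F closed)))

-- Choice of the parameters

record Parameters (w c k s : ℕ) (c≥1 : 1 ≤ c) : Set where
  field
    N : ℕ
  open Core w c k s N c≥1 using (K; X; D; light)
  field
    total : N + K ≡ suc w * s + c
    K<s : K < s
    D-room : D + w ≤ N
    X-room : X + w ≤ N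
    light<₁ : light < binom (N ∸ X) w * (3 + (c + c))
    light<₂ : light < binom (N ∸ D) w * K

parameters : ∀ w c (c≥1 : 1 ≤ c) → ∃ λ k → ∃ λ s₀ → ∀ s → s₀ ≤ s → Parameters w c k s c≥1
parameters w c c≥1 = k , s₀ , λ s h → build s (m≤n⇒∃[o]m+o≡n h)
  where
  z k K X b p y₀ s₀ : ℕ
  z = 2 * suc w
  k = (3 + (c + c)) * z ^ w
  K = suc k + suc (c + c)
  X = suc K * w
  b = X + suc k
  p = sumOver {suc (c + c)} (λ _ → 1)
  -- One multiple of the ball covers both the shift from `y` to `b + y` in `2 + (c + c)` copies and
  -- the second term of `light`.
  negligible = ball-negligible w ((2 + (c + c)) * b + p) b
  y₀ = proj₁ negligible
  -- Makes `u = s − K − w` at least `w`, `w * w` and `y₀`; the 1 ensures `K < s`.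
  s₀ = K + w + (1 + w + w * w + y₀)

  light-bound : ∀ B B′ β → B′ ≤ B + b * β → ((2 + (c + c)) * b + p) * β < B → B′ * (2 + (c + c)) + β * p < B * (3 + (c + c))
  light-bound B B′ β h₁ h₂ = go b p h₁ h₂
    where
    go : ∀ b p → B′ ≤ B + b * β → ((2 + (c + c)) * b + p) * β < B → B′ * (2 + (c + c)) + β * p < B * (3 + (c + c))
    go b p h₁ h₂ = ≤-by 0 (+-mono-≤ (scale (2 + (c + c)) h₁) h₂) (solve (B ∙ B′ ∙ β ∙ b ∙ p ∙ c ∙ ε))

  -- Absent singletons of the link at D are counted with N ∸ D ≈ s points in place of N ∸ X ≈ m s ones;
  -- this is where the factor (2m)^w in k comes from.
  many-singles : ∀ B B₂ → B ≤ z ^ w * B₂ → B * (3 + (c + c)) ≤ B₂ * K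
  many-singles B B₂ h = go (z ^ w) h
    where
    go : ∀ Z → B ≤ Z * B₂ → B * (3 + (c + c)) ≤ B₂ * (suc ((3 + (c + c)) * Z) + suc (c + c))
    go Z h = ≤-by (B₂ * (2 + (c + c))) (scale (3 + (c + c)) h) (solve (B ∙ B₂ ∙ Z ∙ c ∙ ε))

  build : ∀ s → ∃ (λ o → s₀ + o ≡ s) → Parameters w c k s c≥1
  build _ (o , refl) = record
    { N = N
    ; total = total
    ; K<s = ≤-trans (s≤s (m≤m+n K (w + (w + w * w + y₀ + o)))) (≤-reflexive (rearrange K w (w * w) y₀ o))
    ; D-room = ≤-trans (+-monoʳ-≤ D (≤-trans (m≤m+n w _) (≤-reflexive (sym (+-assoc w u c))))) (≤-reflexive (sym N≡D))
    ; X-room = ≤-trans (+-monoʳ-≤ X w≤y) (≤-reflexive (sym N≡X))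
    ; light<₁ = light₁
    ; light<₂ = <-≤-trans light₁ (many-singles _ _
        (subst₂ (λ x x′ → binom x w ≤ z ^ w * binom x′ w) (sym N∸X) (sym N∸D) (binom-ratio z y (w + u + c) w (ratio w u c u≥))))
    }
    where
    u s N D y : ℕ
    u = 1 + w + w * w + y₀ + o
    s = s₀ + o
    -- This is `m * s + c − K`, expanded with `s = K + w + u`.
    N = w * K + suc w * (w + u) + c
    D = w * s
    y = w * w + suc w * u + c
    eu : s ≡ K + w + u
    eu = +-assoc (K + w) (1 + w + w * w + y₀) o
    total : N + K ≡ suc w * s + c
    total = trans (go K c w u) (cong (λ x → suc w * x + c) (sym eu))
      where
      go : ∀ K c w u → w * K + suc w * (w + u) + c + K ≡ suc w * (K + w + u) + c
      go K c w u = solve (K ∙ c ∙ w ∙ u ∙ ε)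
    rearrange : ∀ K w v y o → suc (K + (w + (w + v + y + o))) ≡ K + w + (1 + w + v + y) + o
    rearrange K w v y o = solve (K ∙ w ∙ v ∙ y ∙ o ∙ ε)
    N≡X : N ≡ X + y
    N≡X = go K w u c
      where
      go : ∀ K w u c → w * K + suc w * (w + u) + c ≡ suc K * w + (w * w + suc w * u + c)
      go K w u c = solve (K ∙ w ∙ u ∙ c ∙ ε)
    N≡D : N ≡ D + (w + u + c)
    N≡D = trans (go K w u c) (cong (λ x → w * x + (w + u + c)) (sym eu))
      where
      go : ∀ K w u c → w * K + suc w * (w + u) + c ≡ w * (K + w + u) + (w + u + c)
      go K w u c = solve (K ∙ w ∙ u ∙ c ∙ ε)
    N∸X : N ∸ X ≡ y
    N∸X = trans (cong (_∸ X) N≡X) (m+n∸m≡n X y)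
    N∸D : N ∸ D ≡ w + u + c
    N∸D = trans (cong (_∸ D) N≡D) (m+n∸m≡n D _)
    u≥ : w * w ≤ u
    u≥ = go w (w * w) y₀ o
      where
      go : ∀ w v y o → v ≤ 1 + w + v + y + o
      go w v y o = ≤-by (1 + w + y + o) (z≤n {0}) (solve (w ∙ v ∙ y ∙ o ∙ ε))
    w≤u : w ≤ u
    w≤u = go w (w * w) y₀ o
      where
      go : ∀ w v y o → w ≤ 1 + w + v + y + o
      go w v y o = ≤-by (1 + v + y + o) (z≤n {0}) (solve (w ∙ v ∙ y ∙ o ∙ ε))
    y₀≤u : y₀ ≤ u
    y₀≤u = ≤-trans (m≤n+m y₀ (1 + w + w * w)) (m≤m+n _ o)
    u≤y : u ≤ y
    u≤y = go w u c (w * w)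
      where
      go : ∀ w u c v → u ≤ v + suc w * u + c
      go w u c v = ≤-by (v + w * u + c) (z≤n {0}) (solve (w ∙ u ∙ c ∙ v ∙ ε))
    w≤y : w ≤ y
    w≤y = ≤-trans w≤u u≤y
    ratio : ∀ w u c → w * w ≤ u → w * w + suc w * u + c + 2 * suc w * w ≤ 2 * suc w * (w + u + c)
    ratio w u c h = ≤-by (w * u + c + 2 * w * c) h (solve (w ∙ u ∙ c ∙ ε))
    N₀≡ : N + suc k ≡ b + y
    N₀≡ = trans (cong (_+ suc k) N≡X) (go X y (suc k))
      where
      go : ∀ a b c → a + b + c ≡ a + c + b
      go a b c = solve (a ∙ b ∙ c ∙ ε)
    light₁ : binom (N + suc k) w * suc (suc (c + c)) + ball (N + suc k) w * p < binom (N ∸ X) w * (3 + (c + c))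
    light₁ = subst₂ (λ x x′ → binom x w * suc (suc (c + c)) + ball x w * p < binom x′ w * (3 + (c + c))) (sym N₀≡) (sym N∸X)
      (light-bound (binom y w) (binom (b + y) w) (ball (b + y) w) (binom-shift b y w) (proj₂ negligible y (≤-trans y₀≤u u≤y)))

-- Shiftedness of the extremal families

filter-length-mono : ∀ a {xs ys} → Pointwise _≥_ xs ys → length (filter (_≤? a) xs) ≤ length (filter (_≤? a) ys)
filter-length-mono a [] = z≤n
filter-length-mono a {x ∷ xs} {y ∷ ys} (x≥y ∷ h) with x ≤? a | y ≤? a
... | yes p | yes q =
  subst₂ _≤_ (sym (cong length (filter-accept (_≤? a) {x} {xs} p))) (sym (cong length (filter-accept (_≤? a) {y} {ys} q))) (s≤s (filter-length-mono a h))
... | yes p | no q = ⊥-elim (q (≤-trans x≥y p))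
... | no p | yes q =
  subst₂ _≤_ (sym (cong length (filter-reject (_≤? a) {x} {xs} p))) (sym (cong length (filter-accept (_≤? a) {y} {ys} q))) (m≤n⇒m≤1+n (filter-length-mono a h))
... | no p | no q =
  subst₂ _≤_ (sym (cong length (filter-reject (_≤? a) {x} {xs} p))) (sym (cong length (filter-reject (_≤? a) {y} {ys} q))) (filter-length-mono a h)

Q-shifted : ∀ m s c → Shifted (Q m s c)
Q-shifted m s c A B h p = ≤⇒≤ᵇ {2 * m} (≤-trans (≤ᵇ⇒≤ (2 * m) _ h) (+-mono-≤ (≤-reflexive (Pw.Pointwise-length p)) (filter-length-mono (m * s ∸ c ∸ 1) p)))

W-shifted : ∀ m s c → Shifted (W m s c)
W-shifted m s c A B h p = ≤⇒≤ᵇ {m} (≤-trans (≤ᵇ⇒≤ m _ h) (filter-length-mono (m * s ∸ 1) p))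

-- The variable `n` lets the equation be matched; `m * s + c` does not compute to a sum with the
-- prefix length.
count-light-cast : ∀ {n} N R w → n ≡ N + R → count {n} (not ∘ heavy (2 * suc w) N) ≤ binom N w * suc R + ball N w * sumOver {R} (λ _ → 1)
count-light-cast N R w refl = count-light N R w

count-lower≡heavy-cast : ∀ {n} N w → n ≡ N + 3 → count {n} (λ P → suc w ≤ᵇ lo (N + 1) P) ≡ count {n} (heavy (2 * suc w) N)
count-lower≡heavy-cast N w refl = count-lower≡heavy N w

count-complement-< : ∀ {n} (F G : Family n) → count (not ∘ F) < count (not ∘ G) → count G < count F
count-complement-< F G h = go (count F) (count G) _ _ (trans (count-complement F) (sym (count-complement G))) h
  where
  go : ∀ f g f′ g′ → f + f′ ≡ g + g′ → f′ < g′ → g < f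
  go f g f′ g′ e h = ≤-by 0 (+-mono-≤ (≤-reflexive (sym e)) h) (solve (f ∙ g ∙ f′ ∙ g′ ∙ ε))

count-cong : ∀ {n} {F G : Family n} → F ≐ G → count F ≡ count G
count-cong h = sumOver-cong λ P → cong bit (h P)

card≡⇒count≡ : ∀ {n} (F G : Family n) → card F ≡ card G → count F ≡ count G
card≡⇒count≡ F G e = trans (sym (card≡count F)) (trans e (card≡count G))

-- Extremality and uniqueness

module Extremal (w c k s : ℕ) (c≥1 : 1 ≤ c) (params : Parameters w c k s c≥1) where

  open Parameters params
  open Core w c k s N c≥1 using (K; N₀; light; core)

  m n : ℕ
  m = suc w
  n = m * s + c

  cut : N₀ + suc c ≡ m * s
  cut = +-cancelʳ-≡ c _ _ (trans (go N k c) total)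
    where
    go : ∀ N k c → N + suc k + suc c + c ≡ N + (suc k + suc (c + c))
    go N k c = solve (N ∙ k ∙ c ∙ ε)

  m*s∸1 : m * s ∸ 1 ≡ N₀ + c
  m*s∸1 = cong (_∸ 1) (trans (sym cut) (+-suc N₀ c))

  m*s∸c∸1 : m * s ∸ c ∸ 1 ≡ N₀
  m*s∸c∸1 = trans (∸-+-assoc (m * s) c 1) (trans (cong₂ _∸_ (sym cut) (+-comm c 1)) (m+n∸n≡m N₀ (suc c)))

  Q≐heavy : Q m s c ≐ heavy (2 * m) N₀
  Q≐heavy P = cong (2 * m ≤ᵇ_) (cong₂ _+_ (size≡# P) (trans (cong (λ a → sizeBelow a P) m*s∸c∸1) (sizeBelow≡lo N₀ P)))

  W≐lower : W m s c ≐ (λ P → m ≤ᵇ lo (N₀ + c) P)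
  W≐lower P = cong (m ≤ᵇ_) (trans (cong (λ a → sizeBelow a P) m*s∸1) (sizeBelow≡lo (N₀ + c) P))

  -- Members of a matching of size `s` would weigh at least `2 * m * s`, but the ground set weighs
  -- `m * s + c + N₀`, which is one less.
  νQ : νLt (Q m s c) s
  νQ M = <-irrefl refl (go (HasMatching-weight (2 * m) N₀ (Q m s c) (λ P h → ≤ᵇ⇒≤ _ _ (subst T (Q≐heavy P) h)) M) cut)
    where
    go : s * (2 * suc w) ≤ suc w * s + c + N₀ → N₀ + suc c ≡ suc w * s → N₀ < N₀
    go h e = go′ N₀ h e
      where
      go′ : ∀ x → s * (2 * suc w) ≤ suc w * s + c + x → x + suc c ≡ suc w * s → x < x
      go′ x h e = ≤-by 0 (+-mono-≤ h (≤-reflexive e)) (solve (s ∙ w ∙ c ∙ x ∙ ε))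

  νW : νLt (W m s c) s
  νW M = <⇒≱ (≤-reflexive (trans (sym (+-suc N₀ c)) cut)) (≤-trans (≤-reflexive (*-comm m s))
    (HasMatching-lo m (N₀ + c) (W m s c) (λ P h → ≤ᵇ⇒≤ _ _ (subst T (W≐lower P) h)) M))

  count-W : c ≡ 1 → count (W m s c) ≡ count (Q m s c)
  count-W refl = trans (count-cong {F = W m s c} W≐lower)
    (trans (count-lower≡heavy-cast N₀ w (trans (sym total) (sym (+-assoc N (suc k) 3)))) (sym (count-cong {F = Q m s c} Q≐heavy)))

  core-cast : ∀ {n} → N + K ≡ n → (F : Family n) → DomClosed F → νLt F s →
              light < count (not ∘ F) ⊎ (∀ P → T (F P) → 2 * suc w ≤ # P + lo N₀ P) ⊎ (c ≡ 1 × (∀ P → T (F P) → suc w ≤ lo (N + (2 + k)) P))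
  core-cast refl F cl ν = core total K<s D-room X-room light<₁ light<₂ F cl ν

  trichotomy : ∀ (F : Family n) → Stable F → νLt F s →
               count F < count (Q m s c) ⊎ (∀ P → T (F P) → T (Q m s c P)) ⊎ (c ≡ 1 × (∀ P → T (F P) → T (W m s c P)))
  trichotomy F st ν with core-cast total F (Stable⇒DomClosed st) ν
  -- `F` misses more than `light` sets, and `Q` misses at most that many.
  ... | inj₁ h = inj₁ (count-complement-< (Q m s c) F (≤-<-trans (≤-trans (≤-reflexive (count-cong λ P → cong not (Q≐heavy P)))
          (count-light-cast N₀ (suc (c + c)) w (trans (sym total) (sym (+-assoc N (suc k) (suc (c + c))))))) h))
  ... | inj₂ (inj₁ h) = inj₂ (inj₁ λ P FP → subst T (sym (Q≐heavy P)) (≤⇒≤ᵇ (h P FP)))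
  ... | inj₂ (inj₂ (refl , h)) = inj₂ (inj₂ (refl , λ P FP → subst T (sym (W≐lower P)) (≤⇒≤ᵇ (subst (λ z → suc w ≤ lo z P) (go N k) (h P FP)))))
    where
    go : ∀ N k → N + (2 + k) ≡ N + suc k + 1
    go N k = solve (N ∙ k ∙ ε)

  maximum : ∀ (F : Family n) → νLt F s → card F ≤ card (Q m s c)
  maximum F ν with stabilize F ν
  ... | G , st , νG , e = subst₂ _≤_ (trans e (sym (card≡count F))) (sym (card≡count (Q m s c))) (bound (trichotomy G st νG))
    where
    bound : count G < count (Q m s c) ⊎ (∀ P → T (G P) → T (Q m s c P)) ⊎ (c ≡ 1 × (∀ P → T (G P) → T (W m s c P))) → count G ≤ count (Q m s c)
    bound (inj₁ h) = <⇒≤ h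
    bound (inj₂ (inj₁ h)) = count-mono G (Q m s c) h
    bound (inj₂ (inj₂ (c≡1 , h))) = ≤-trans (count-mono G (W m s c) h) (≤-reflexive (count-W c≡1))

  -- A shifted family is already stable, and an inclusion between families of equal size is an
  -- equality.
  equality : ∀ (F : Family n) → Shifted F → νLt F s → card F ≡ card (Q m s c) → F ≐ Q m s c ⊎ (c ≡ 1 × F ≐ W m s c)
  equality F sh ν e with card≡⇒count≡ F (Q m s c) e | trichotomy F (Shifted⇒Stable sh) ν
  ... | e′ | inj₁ h = ⊥-elim (<-irrefl e′ h)
  ... | e′ | inj₂ (inj₁ h) = inj₁ (⊆∧count≡⇒≐ F (Q m s c) h e′)
  ... | e′ | inj₂ (inj₂ (c≡1 , h)) = inj₂ (c≡1 , ⊆∧count≡⇒≐ F (W m s c) h (trans e′ (sym (count-W c≡1))))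

theorem1 : (m c : ℕ) → m ≥ 1 → c ≥ 1 →
    Σ ℕ λ s₀ → (s : ℕ) → s ≥ s₀ →
    IsE (m * s + c) s (card (Q m s c)) ×
    (c ≥ 2 →
    Shifted (Q m s c) × νLt (Q m s c) s ×
    ((F : Family (m * s + c)) → Shifted F → νLt F s →
    card F ≡ card (Q m s c) → F ≐ Q m s c)) ×
    (c ≡ 1 →
    Shifted (Q m s c) × νLt (Q m s c) s ×
    Shifted (W m s c) × νLt (W m s c) s × card (W m s c) ≡ card (Q m s c) ×
    ((F : Family (m * s + c)) → Shifted F → νLt F s →
    card F ≡ card (Q m s c) → (F ≐ Q m s c) ⊎ (F ≐ W m s c)))
theorem1 (suc w) c m≥1 c≥1 with parameters w c c≥1
... | k , s₀ , params = s₀ , conclusion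
  where
  conclusion : ∀ s → s₀ ≤ s → _
  conclusion s s≥s₀ =
      ((Q m s c , νQ , refl) , maximum)
    , (λ c≥2 → Q-shifted m s c , νQ , λ F sh ν e → fromInj₁ (λ (c≡1 , _) → ⊥-elim (<⇒≢ c≥2 (sym c≡1))) (equality F sh ν e))
    , (λ c≡1 → Q-shifted m s c , νQ , W-shifted m s c , νW ,
         trans (card≡count (W m s c)) (trans (count-W c≡1) (sym (card≡count (Q m s c)))) ,
         λ F sh ν e → map₂ proj₂ (equality F sh ν e))
    where open Extremal w c k s c≥1 (params s s≥s₀)
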